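{- Let $\mathbb{F}$ be a field. For the Erdős–Rényi random graph $G = G(n,\tfrac12)$ on $n$ vertices, $$\Pr\big[\mathbb{F}\langle\langle A_G \rangle\rangle = M_n(\mathbb{F})\big] \to 1 \quad \text{as } n \to \infty.$$
   Context: $A_G$ is the adjacency matrix of $G$. $M_n(\mathbb{F})$ carries two multiplications: the matrix product $\bullet$, with identity $I$, and the Hadamard (entrywise) product $\circ$, with identity $J$, the all-ones matrix. For $a \in M_n(\mathbb{F})$, $\mathbb{F}\langle\langle a \rangle\rangle$ denotes the smallest linear subspace of $M_n(\mathbb{F})$ that contains $a$, $I$ and $J$ and is closed under both $\bullet$ and $\circ$. -}

module Defs where

open import Level using (Level; _⊔_; suc)
open import Algebra.Bundles using (CommutativeRing)
open import Data.Nat as ℕ using (ℕ; _≥_; _^_)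
open import Data.Fin as Fin using (Fin)
open import Data.Fin.Properties as FinP using ()
open import Data.Bool using (Bool; true; false; if_then_else_; _∧_; _∨_)
open import Data.List as List using (List; []; _∷_; length; allFin; filter; concatMap)
open import Data.Bool.ListAction using (any)
open import Data.List.Relation.Unary.All using (All)
open import Data.List.Relation.Unary.Unique.Propositional using (Unique)
open import Data.Vec as Vec using (Vec; toList)
open import Data.Product using (_×_; _,_; Σ; ∃; ∃-syntax)
open import Relation.Nullary using (¬_; does)

record Field (c ℓ : Level) : Set (suc (c ⊔ ℓ)) where
  field
    commutativeRing : CommutativeRing c ℓ
  open CommutativeRing commutativeRing public
  field
    0≉1     : ¬ (0# ≈ 1#)
    inverse : ∀ x → ¬ (x ≈ 0#) → ∃[ y ] (x * y ≈ 1#)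

pairs : (n : ℕ) → List (Fin n × Fin n)
pairs n = concatMap (λ i → List.map (λ j → (i , j)) (filter (λ j → i Fin.<? j) (allFin n))) (allFin n)

-- A graph on n vertices: one bit per unordered pair (edge present or not).
-- There are exactly 2 ^ (n choose 2) of them, and G(n,1/2) is the uniform
-- distribution on this set.
Graph : ℕ → Set
Graph n = Vec Bool (length (pairs n))

adj : {n : ℕ} → Graph n → Fin n → Fin n → Bool
adj {n} g i j = any test (List.zip (pairs n) (toList g))
  where
  test : (Fin n × Fin n) × Bool → Bool
  test ((a , b) , e) =
    e ∧ ((does (a Fin.≟ i) ∧ does (b Fin.≟ j)) ∨ (does (a Fin.≟ j) ∧ does (b Fin.≟ i)))

module _ {c ℓ : Level} (F : Field c ℓ) where
  open Field F

  Mat : ℕ → Set c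
  Mat n = Fin n → Fin n → Carrier

  _≋_ : {n : ℕ} → Mat n → Mat n → Set ℓ
  A ≋ B = ∀ i j → A i j ≈ B i j

  Iₘ : {n : ℕ} → Mat n
  Iₘ i j = if does (i Fin.≟ j) then 1# else 0#

  Jₘ : {n : ℕ} → Mat n
  Jₘ i j = 1#

  _+ₘ_ : {n : ℕ} → Mat n → Mat n → Mat n
  (A +ₘ B) i j = A i j + B i j

  _·ₘ_ : {n : ℕ} → Carrier → Mat n → Mat n
  (λ' ·ₘ A) i j = λ' * A i j

  Σᶠ : {n : ℕ} → (Fin n → Carrier) → Carrier
  Σᶠ {ℕ.zero}  f = 0#
  Σᶠ {ℕ.suc n} f = f Fin.zero + Σᶠ (λ k → f (Fin.suc k))

  _•_ : {n : ℕ} → Mat n → Mat n → Mat n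
  (A • B) i j = Σᶠ (λ k → A i k * B k j)

  _∘ₕ_ : {n : ℕ} → Mat n → Mat n → Mat n
  (A ∘ₕ B) i j = A i j * B i j

  -- Membership in F⟨⟨a⟩⟩: the smallest subset containing a, I, J, closed under
  -- linear combinations, • and ∘ (and under entrywise equality of matrices).
  -- This is exactly the smallest linear subspace containing a, I, J and
  -- closed under both multiplications.
  data InClosure {n : ℕ} (a : Mat n) : Mat n → Set (c ⊔ ℓ) where
    gen   : InClosure a a
    unit• : InClosure a Iₘ
    unit∘ : InClosure a Jₘ
    add   : ∀ {A B} → InClosure a A → InClosure a B → InClosure a (A +ₘ B)
    scale : ∀ {A} (λ' : Carrier) → InClosure a A → InClosure a (λ' ·ₘ A)
    mul   : ∀ {A B} → InClosure a A → InClosure a B → InClosure a (A • B)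
    had   : ∀ {A B} → InClosure a A → InClosure a B → InClosure a (A ∘ₕ B)
    resp  : ∀ {A B} → A ≋ B → InClosure a A → InClosure a B

  GeneratesAll : {n : ℕ} → Mat n → Set (c ⊔ ℓ)
  GeneratesAll {n} a = (m : Mat n) → InClosure a m

  adjMat : {n : ℕ} → Graph n → Mat n
  adjMat g i j = if adj g i j then 1# else 0#

  -- Pr_{G ~ G(n,1/2)} [ F⟨⟨A_G⟩⟩ = M_n(F) ] ≥ 1 - 1/(k+1), stated by exhibiting
  -- a duplicate-free list of "good" graphs with at least that proportion
  -- of all 2 ^ (n choose 2) graphs.
  ProbAtLeast : ℕ → ℕ → Set (c ⊔ ℓ)
  ProbAtLeast n k =
    Σ (List (Graph n)) λ S →
      Unique S × All (λ (g : Graph n) → GeneratesAll (adjMat {n} g)) S ×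
      (ℕ.suc k ℕ.* length S ≥ k ℕ.* 2 ^ length (pairs n))

  ProbTendsToOne : Set (c ⊔ ℓ)
  ProbTendsToOne = (k : ℕ) → ∃[ N ] ((n : ℕ) → n ≥ N → ProbAtLeast n k)

module Submission where

-- The characteristic of F cannot be decided, so the argument runs over ℤ: the integer vectors x for
-- which the matrix with entries x i in row i lies in F⟨⟨A⟩⟩ form a ring closed under x ↦ A x.
-- If no partition of the vertices other than the discrete one is equitable modulo some p ≥ 2, then
-- refining modulo a prime separates any two vertices; as this holds for every prime, a Euclidean
-- descent yields a vector whose values at the two vertices differ by exactly 1. Products of such
-- vectors are indicators of single vertices, and these give all matrix units.
--
-- A partition into m classes is described by the idempotent map ρ to class representatives.
-- Equitability determines many edges from the others, which is played off against the number of ρ.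
-- For m ≤ 10 log n, the edges from representatives to vertices that are neither representatives
-- nor a chosen second vertex of their class are determined: at least m (n - 2m) of them, against
-- at most n^m m^n maps. For larger m, every pair of classes is oriented and the edges from the
-- non-representatives of the first to the representative of the second are determined: with one
-- of two opposite orientations at least (n - m)(m - 1) / 2 of them, against n^(2 (n - m)) maps.

open import Defs
open import Level using (Level)
open import Data.Bool using (Bool; true; false; if_then_else_; _∧_; _∨_)
open import Data.Bool.Properties using (∧-zeroʳ; ∨-identityʳ; ∧-identityʳ; ∨-comm)
open import Data.Bool.ListAction using (any)
open import Data.Fin as Fin using (Fin; zero; suc; toℕ; fromℕ<)
import Data.Fin.Properties as Fin
open import Data.List as List
  using (List; []; _∷_; _++_; length; filter; map; allFin; zip; upTo; cartesianProduct; cartesianProductWith)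
open import Data.List.Properties
  using (length-++; length-map; length-tabulate; length-upTo; ++-identityʳ;
    filter-++; filter-accept; filter-reject; filter-none; filter-≐)
open import Data.List.Membership.Propositional using (_∈_; lose)
open import Data.List.Membership.Propositional.Properties
open import Data.List.Relation.Unary.All as All using (All; []; _∷_)
import Data.List.Relation.Unary.All.Properties as All
open import Data.List.Relation.Unary.AllPairs as AllPairs using ([]; _∷_)
import Data.List.Relation.Unary.AllPairs.Properties as AllPairs
open import Data.List.Relation.Unary.Any as Any using (Any; here; there)
import Data.List.Relation.Unary.Any.Properties as Any
open import Data.List.Relation.Unary.Unique.Propositional using (Unique)
import Data.List.Relation.Unary.Unique.Propositional.Properties as Unique
open import Data.Nat using (ℕ)
open import Data.Product using (_×_; _,_; proj₁; proj₂; ∃; ∃-syntax)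
open import Data.Product.Properties using (,-injectiveʳ; ≡-dec)
open import Data.Sum using (_⊎_; inj₁; inj₂; [_,_]′)
open import Data.Unit using (tt)
open import Data.Vec as Vec using (Vec; []; _∷_; toList; lookup; tabulate; fromList; _[_]≔_)
open import Data.Vec.Properties
  using (∷-injective; lookup∘tabulate; tabulate∘lookup; tabulate-cong; lookup-map; lookup∘update; lookup∘update′)
open import Function using (_∘_; id; case_of_)
open import Relation.Binary.Definitions using (tri<; tri≈; tri>)
open import Relation.Nullary using (¬_; Dec; yes; no; does; contradiction; ¬?)
open import Relation.Nullary.Decidable as Dec using (_⊎-dec_; _×-dec_; dec-true; dec-false)
open import Relation.Unary using (Pred; Decidable)

private variable
  n : ℕ

-- Counting in finite lists: unions, injections, and bit vectors with determined positions.

module Counting where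

  open import Data.Nat
    using (ℕ; zero; suc; _+_; _*_; _^_; _≤_; _<_; z≤n; s≤s)
  open import Data.Nat.Properties
  open import Relation.Binary.PropositionalEquality

  private variable
    a b ℓ₁ ℓ₂ : Level
    A B C : Set a

  vecs : List A → (n : ℕ) → List (Vec A n)
  vecs xs zero    = [] ∷ []
  vecs xs (suc n) = cartesianProductWith _∷_ xs (vecs xs n)

  length-cartesianProductWith : ∀ (f : A → B → C) xs ys →
    length (cartesianProductWith f xs ys) ≡ length xs * length ys
  length-cartesianProductWith f []       ys = refl
  length-cartesianProductWith f (x ∷ xs) ys = trans (length-++ (map (f x) ys))
    (cong₂ _+_ (length-map (f x) ys) (length-cartesianProductWith f xs ys))

  length-vecs : ∀ (xs : List A) n → length (vecs xs n) ≡ length xs ^ n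
  length-vecs xs zero    = refl
  length-vecs xs (suc n) =
    trans (length-cartesianProductWith _∷_ xs (vecs xs n)) (cong (length xs *_) (length-vecs xs n))

  vecs-unique : ∀ {xs : List A} n → Unique xs → Unique (vecs xs n)
  vecs-unique zero    u = [] ∷ []
  vecs-unique (suc n) u = Unique.cartesianProductWith⁺ _∷_ ∷-injective u (vecs-unique n u)

  ∈-vecs : ∀ {xs : List A} {n} (v : Vec A n) → (∀ i → lookup v i ∈ xs) → v ∈ vecs xs n
  ∈-vecs []      h = here refl
  ∈-vecs (x ∷ v) h = ∈-cartesianProductWith⁺ _∷_ (h zero) (∈-vecs v (h ∘ suc))

  bits : List Bool
  bits = false ∷ true ∷ []

  bits-unique : Unique bits
  bits-unique = ((λ ()) ∷ []) ∷ [] ∷ []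

  length-filter-map : ∀ {P : Pred B ℓ₁} (P? : Decidable P) (f : A → B) xs →
    length (filter P? (map f xs)) ≡ length (filter (P? ∘ f) xs)
  length-filter-map P? f []       = refl
  length-filter-map P? f (x ∷ xs) with does (P? (f x))
  ... | true  = cong suc (length-filter-map P? f xs)
  ... | false = length-filter-map P? f xs

  length-filter-∁ : ∀ {P : Pred A ℓ₁} (P? : Decidable P) xs →
    length (filter P? xs) + length (filter (¬? ∘ P?) xs) ≡ length xs
  length-filter-∁ P? []       = refl
  length-filter-∁ P? (x ∷ xs) with does (P? x)
  ... | true  = cong suc (length-filter-∁ P? xs)
  ... | false = trans (+-suc (length (filter P? xs)) _) (cong suc (length-filter-∁ P? xs))

  length-filter-⊎ : ∀ {P : Pred A ℓ₁} {Q : Pred A ℓ₂} (P? : Decidable P) (Q? : Decidable Q) xs →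
    length (filter (λ x → P? x ⊎-dec Q? x) xs) ≤ length (filter P? xs) + length (filter Q? xs)
  length-filter-⊎ P? Q? []       = z≤n
  length-filter-⊎ P? Q? (x ∷ xs) with does (P? x) | does (Q? x)
  ... | true  | true  = s≤s (≤-trans (length-filter-⊎ P? Q? xs) (+-monoʳ-≤ (length (filter P? xs)) (n≤1+n _)))
  ... | true  | false = s≤s (length-filter-⊎ P? Q? xs)
  ... | false | true  = ≤-trans (s≤s (length-filter-⊎ P? Q? xs)) (≤-reflexive (sym (+-suc (length (filter P? xs)) _)))
  ... | false | false = length-filter-⊎ P? Q? xs

  length-filter-⊆ : ∀ {P : Pred A ℓ₁} {Q : Pred A ℓ₂} (P? : Decidable P) (Q? : Decidable Q) →
    (∀ {x} → P x → Q x) → ∀ xs → length (filter P? xs) ≤ length (filter Q? xs)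
  length-filter-⊆ P? Q? P⊆Q []       = z≤n
  length-filter-⊆ P? Q? P⊆Q (x ∷ xs) with P? x | Q? x
  ... | yes _  | yes _  = s≤s (length-filter-⊆ P? Q? P⊆Q xs)
  ... | no _   | yes _  = m≤n⇒m≤1+n (length-filter-⊆ P? Q? P⊆Q xs)
  ... | no _   | no _   = length-filter-⊆ P? Q? P⊆Q xs
  ... | yes px | no ¬qx = contradiction (P⊆Q px) ¬qx

  length-filter-⊂ : ∀ {P : Pred A ℓ₁} {Q : Pred A ℓ₂} (P? : Decidable P) (Q? : Decidable Q) →
    (∀ {x} → P x → Q x) → ∀ {y xs} → y ∈ xs → Q y → ¬ P y →
    length (filter P? xs) < length (filter Q? xs)
  length-filter-⊂ P? Q? P⊆Q {xs = x ∷ xs} (here refl) qy ¬py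
    rewrite filter-reject P? {xs = xs} ¬py | filter-accept Q? {xs = xs} qy = s≤s (length-filter-⊆ P? Q? P⊆Q xs)
  length-filter-⊂ P? Q? P⊆Q {xs = x ∷ xs} (there y∈) qy ¬py with P? x | Q? x
  ... | yes _  | yes _  = s≤s (length-filter-⊂ P? Q? P⊆Q y∈ qy ¬py)
  ... | no _   | yes _  = m≤n⇒m≤1+n (length-filter-⊂ P? Q? P⊆Q y∈ qy ¬py)
  ... | no _   | no _   = length-filter-⊂ P? Q? P⊆Q y∈ qy ¬py
  ... | yes px | no ¬qx = contradiction (P⊆Q px) ¬qx

  length-filter-disjoint : ∀ {P : Pred A ℓ₁} {Q : Pred A ℓ₂} (P? : Decidable P) (Q? : Decidable Q) →
    (∀ {x} → P x → ¬ Q x) → ∀ xs →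
    length (filter P? xs) + length (filter Q? xs) ≤ length (filter (λ x → P? x ⊎-dec Q? x) xs)
  length-filter-disjoint P? Q? P#Q []       = z≤n
  length-filter-disjoint P? Q? P#Q (x ∷ xs) with P? x | Q? x
  ... | yes px | yes qx = contradiction qx (P#Q px)
  ... | yes _  | no _   = s≤s (length-filter-disjoint P? Q? P#Q xs)
  ... | no _   | yes _  = ≤-trans (≤-reflexive (+-suc (length (filter P? xs)) _)) (s≤s (length-filter-disjoint P? Q? P#Q xs))
  ... | no _   | no _   = length-filter-disjoint P? Q? P#Q xs

  -- `T` stands for the size of the whole space and 1/`W` for a probability; `W` is kept as a factor
  -- on the left to avoid division.
  union-bound : ∀ {I : Set a} {P : I → Pred A ℓ₁} (P? : ∀ i → Decidable (P i))
    (xs : List A) (is : List I) {W T : ℕ} →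
    (∀ i → length (filter (P? i) xs) * W ≤ T) →
    length (filter (λ x → Any.any? (λ i → P? i x) is) xs) * W ≤ length is * T
  union-bound P? xs [] {W} h = ≤-reflexive (cong (_* W) (none xs))
    where
    none : ∀ ys → length (filter (λ x → Any.any? (λ i → P? i x) []) ys) ≡ 0
    none []       = refl
    none (_ ∷ ys) = none ys
  union-bound {P = P} P? xs (i ∷ is) {W} {T} h = begin
    length (filter (λ x → Any.any? (λ i → P? i x) (i ∷ is)) xs) * W
      ≤⟨ *-monoˡ-≤ W (length-filter-⊆ _ (λ x → P? i x ⊎-dec Any.any? (λ i → P? i x) is)
          (λ { (here px) → inj₁ px ; (there px) → inj₂ px }) xs) ⟩
    length (filter (λ x → P? i x ⊎-dec Any.any? (λ i → P? i x) is) xs) * W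
      ≤⟨ *-monoˡ-≤ W (length-filter-⊎ (P? i) (λ x → Any.any? (λ i → P? i x) is) xs) ⟩
    (length (filter (P? i) xs) + length (filter (λ x → Any.any? (λ i → P? i x) is) xs)) * W
      ≡⟨ *-distribʳ-+ W (length (filter (P? i) xs)) _ ⟩
    length (filter (P? i) xs) * W + length (filter (λ x → Any.any? (λ i → P? i x) is) xs) * W
      ≤⟨ +-mono-≤ (h i) (union-bound P? xs is h) ⟩
    T + length is * T ∎
    where open ≤-Reasoning

  unique-⊆-length : ∀ {xs ys : List A} → Unique xs → (∀ {x} → x ∈ xs → x ∈ ys) → length xs ≤ length ys
  unique-⊆-length {xs = []}     u xs⊆ys = z≤n
  unique-⊆-length {xs = x ∷ xs} (x∉xs ∷ u) xs⊆ys with ∈-∃++ (xs⊆ys (here refl))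
  ... | ys₁ , ys₂ , refl = begin
    suc (length xs)                   ≤⟨ s≤s (unique-⊆-length u sub) ⟩
    suc (length (ys₁ ++ ys₂))         ≡⟨ cong suc (length-++ ys₁) ⟩
    suc (length ys₁ + length ys₂)     ≡⟨ +-suc (length ys₁) (length ys₂) ⟨
    length ys₁ + suc (length ys₂)     ≡⟨ length-++ ys₁ ⟨
    length (ys₁ ++ x ∷ ys₂)           ∎
    where
    open ≤-Reasoning
    sub : ∀ {y} → y ∈ xs → y ∈ ys₁ ++ ys₂
    sub y∈ with ∈-++⁻ ys₁ (xs⊆ys (there y∈))
    ... | inj₁ y∈₁          = ∈-++⁺ˡ y∈₁
    ... | inj₂ (here refl)  = contradiction refl (All.lookup x∉xs y∈)
    ... | inj₂ (there y∈₂)  = ∈-++⁺ʳ ys₁ y∈₂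

  map-unique : ∀ (f : A → B) {xs : List A} → Unique xs →
    (∀ {x y} → x ∈ xs → y ∈ xs → f x ≡ f y → x ≡ y) → Unique (map f xs)
  map-unique f []       inj = []
  map-unique f (x∉ ∷ u) inj = All.map⁺ (All.tabulate (λ y∈ eq →
    All.lookup x∉ y∈ (inj (here refl) (there y∈) eq))) ∷ map-unique f u (λ x∈ y∈ → inj (there x∈) (there y∈))

  -- Injectivity is asked for on `xs` alone: the maps used below, such as `sort` and `ρ`, are
  -- injective only on a particular list.
  injective-length : ∀ (f : A → B) {xs : List A} {ys : List B} → Unique xs →
    (∀ {x y} → x ∈ xs → y ∈ xs → f x ≡ f y → x ≡ y) → (∀ {x} → x ∈ xs → f x ∈ ys) → length xs ≤ length ys
  injective-length f {xs} {ys} u inj into = ≤-trans (≤-reflexive (sym (length-map f xs)))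
    (unique-⊆-length (map-unique f u inj) (λ y∈ → back (∈-map⁻ f y∈)))
    where
    back : ∀ {y} → ∃ (λ x → x ∈ xs × y ≡ f x) → y ∈ ys
    back (_ , x∈ , refl) = into x∈

  -- Induction over the positions. A free position doubles the bound. At a determined position two
  -- vectors with the same tail cannot differ in the head, so the tails after `false` and those
  -- after `true` are disjoint and can be counted together, under the union of the two predicates.
  determined-bound : ∀ (ps : List A) {D : Pred A ℓ₁} (D? : Decidable D)
    {P : Pred (Vec Bool (length ps)) ℓ₂} (P? : Decidable P) →
    (∀ {g g′} → P g → P g′ → (∀ e → ¬ D (List.lookup ps e) → lookup g e ≡ lookup g′ e) → g ≡ g′) →
    length (filter P? (vecs bits (length ps))) ≤ 2 ^ length (filter (¬? ∘ D?) ps)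
  determined-bound [] D? P? det with does (P? [])
  ... | true  = ≤-refl
  ... | false = z≤n
  determined-bound {A = A} (x ∷ ps) {D} D? {P} P? det = begin
    length (filter P? (map (false ∷_) gs ++ map (true ∷_) gs ++ []))
      ≡⟨ cong length (filter-++ P? (map (false ∷_) gs) _) ⟩
    length (filter P? (map (false ∷_) gs) ++ filter P? (map (true ∷_) gs ++ []))
      ≡⟨ length-++ (filter P? (map (false ∷_) gs)) ⟩
    length (filter P? (map (false ∷_) gs)) + length (filter P? (map (true ∷_) gs ++ []))
      ≡⟨ cong₂ _+_ (length-filter-map P? (false ∷_) gs)
          (trans (cong (λ z → length (filter P? z)) (++-identityʳ (map (true ∷_) gs)))
            (length-filter-map P? (true ∷_) gs)) ⟩
    length (filter P₀? gs) + length (filter P₁? gs)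
      ≤⟨ halves ⟩
    2 ^ length (filter (¬? ∘ D?) (x ∷ ps)) ∎
    where
    open ≤-Reasoning
    gs = vecs bits (length ps)
    P₀? : Decidable (λ g → P (false ∷ g))
    P₀? g = P? (false ∷ g)
    P₁? : Decidable (λ g → P (true ∷ g))
    P₁? g = P? (true ∷ g)
    extend : ∀ {b b′} {g g′ : Vec Bool (length ps)} → (D x ⊎ b ≡ b′) →
      (∀ e → ¬ D (List.lookup ps e) → lookup g e ≡ lookup g′ e) →
      ∀ e → ¬ D (List.lookup (x ∷ ps) e) → lookup (b ∷ g) e ≡ lookup (b′ ∷ g′) e
    extend (inj₁ d)  h zero    ¬d = contradiction d ¬d
    extend (inj₂ eq) h zero    ¬d = eq
    extend _         h (suc e) ¬d = h e ¬d
    tail-det : ∀ b {g g′} → P (b ∷ g) → P (b ∷ g′) →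
      (∀ e → ¬ D (List.lookup ps e) → lookup g e ≡ lookup g′ e) → g ≡ g′
    tail-det b pg pg′ h = proj₂ (∷-injective (det pg pg′ (extend (inj₂ refl) h)))
    halves : length (filter P₀? gs) + length (filter P₁? gs) ≤ 2 ^ length (filter (¬? ∘ D?) (x ∷ ps))
    halves with D? x
    ... | no _  = +-mono-≤ (determined-bound ps D? P₀? (tail-det false))
      (≤-trans (determined-bound ps D? P₁? (tail-det true)) (≤-reflexive (sym (+-identityʳ _))))
    ... | yes d = ≤-trans
      (length-filter-disjoint P₀? P₁?
        (λ p₀ p₁ → case ∷-injective (det p₀ p₁ (extend (inj₁ d) (λ _ _ → refl))) of λ { (() , _) }) gs)
      (determined-bound ps D? (λ g → P₀? g ⊎-dec P₁? g)
        merge)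
      where
      cut : ∀ {b b′ g g′} → P (b ∷ g) → P (b′ ∷ g′) →
        (∀ e → ¬ D (List.lookup ps e) → lookup g e ≡ lookup g′ e) → g ≡ g′
      cut pg pg′ h = proj₂ (∷-injective (det pg pg′ (extend (inj₁ d) h)))
      -- Tails from different halves may be compared as well, because a determined head need not
      -- agree in advance.
      merge : ∀ {g g′} → P (false ∷ g) ⊎ P (true ∷ g) → P (false ∷ g′) ⊎ P (true ∷ g′) →
        (∀ e → ¬ D (List.lookup ps e) → lookup g e ≡ lookup g′ e) → g ≡ g′
      merge (inj₁ u) (inj₁ v) = cut u v
      merge (inj₁ u) (inj₂ v) = cut u v
      merge (inj₂ u) (inj₁ v) = cut u v
      merge (inj₂ u) (inj₂ v) = cut u v

open Counting

-- Adjacency as a function of the edge bits, and graphs with forced edges.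

module Edges where

  open import Data.Nat
    using (ℕ; zero; suc; _+_; _*_; _^_; _≤_; _<_)
  open import Data.Nat.Properties
  open import Relation.Binary.PropositionalEquality

  joins : (i j : Fin n) → Fin n × Fin n → Bool
  joins i j (a , b) =
    (does (a Fin.≟ i) ∧ does (b Fin.≟ j)) ∨ (does (a Fin.≟ j) ∧ does (b Fin.≟ i))

  -- The list is a variable to allow induction; at `pairs n` this unfolds to `adj`.
  adjOn : (ps : List (Fin n × Fin n)) → Vec Bool (length ps) → Fin n → Fin n → Bool
  adjOn ps g i j = any (λ { ((a , b) , e) → e ∧ joins i j (a , b) }) (zip ps (toList g))

  joins⇒ : ∀ {i j : Fin n} p → joins i j p ≡ true → p ≡ (i , j) ⊎ p ≡ (j , i)
  joins⇒ {i = i} {j} (a , b) h with a Fin.≟ i | b Fin.≟ j | a Fin.≟ j | b Fin.≟ i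
  ... | yes refl | yes refl | _        | _        = inj₁ refl
  ... | _        | _        | yes refl | yes refl = inj₂ refl
  joins⇒ (a , b) () | yes _ | no _ | yes _ | no _
  joins⇒ (a , b) () | yes _ | no _ | no _  | _
  joins⇒ (a , b) () | no _  | _    | yes _ | no _
  joins⇒ (a , b) () | no _  | _    | no _  | _

  joins-refl : ∀ (i j : Fin n) → joins i j (i , j) ≡ true
  joins-refl i j rewrite dec-true (i Fin.≟ i) refl | dec-true (j Fin.≟ j) refl = refl

  adjOn-cong : ∀ (ps : List (Fin n × Fin n)) {g g′ i j} →
    (∀ e → joins i j (List.lookup ps e) ≡ true → lookup g e ≡ lookup g′ e) →
    adjOn ps g i j ≡ adjOn ps g′ i j
  adjOn-cong []       {[]} {[]} h = refl
  adjOn-cong (p ∷ ps) {b ∷ g} {b′ ∷ g′} {i} {j} h = cong₂ _∨_ head (adjOn-cong ps (h ∘ suc))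
    where
    head : b ∧ joins i j p ≡ b′ ∧ joins i j p
    head with joins i j p in eq
    ... | true  = cong (_∧ true) (h zero eq)
    ... | false = trans (∧-zeroʳ b) (sym (∧-zeroʳ b′))

  adjOn-none : ∀ (ps : List (Fin n × Fin n)) {g i j} →
    (∀ e → joins i j (List.lookup ps e) ≡ false) → adjOn ps g i j ≡ false
  adjOn-none []       {[]}    h = refl
  adjOn-none (p ∷ ps) {b ∷ g} h =
    cong₂ _∨_ (trans (cong (b ∧_) (h zero)) (∧-zeroʳ b)) (adjOn-none ps (h ∘ suc))

  adjOn-at : ∀ (ps : List (Fin n × Fin n)) {g i j} e → joins i j (List.lookup ps e) ≡ true →
    (∀ e′ → e′ ≢ e → joins i j (List.lookup ps e′) ≡ false) → adjOn ps g i j ≡ lookup g e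
  adjOn-at (p ∷ ps) {b ∷ g} zero    h u = trans
    (cong₂ _∨_ (trans (cong (b ∧_) h) (∧-identityʳ b)) (adjOn-none ps {g} (λ e → u (suc e) λ ())))
    (∨-identityʳ b)
  adjOn-at (p ∷ ps) {b ∷ g} (suc e) h u = cong₂ _∨_
    (trans (cong (b ∧_) (u zero λ ())) (∧-zeroʳ b))
    (adjOn-at ps e h (λ e′ ne → u (suc e′) (ne ∘ Fin.suc-injective)))

  private
    row : (n : ℕ) → Fin n → List (Fin n × Fin n)
    row n i = map (i ,_) (filter (λ j → i Fin.<? j) (allFin n))

  ∈-row : ∀ {i} {p : Fin n × Fin n} → p ∈ row n i → proj₁ p ≡ i × i Fin.< proj₂ p
  ∈-row {n = n} {i} p∈ with ∈-map⁻ (i ,_) p∈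
  ... | j , j∈ , refl = refl , proj₂ (∈-filter⁻ (λ j → i Fin.<? j) {xs = allFin n} j∈)

  ∈-pairs⁻ : ∀ {a b : Fin n} → (a , b) ∈ pairs n → a Fin.< b
  ∈-pairs⁻ {n} p∈ with Any.satisfied (∈-concatMap⁻ (row n) {xs = allFin n} p∈)
  ... | i , q with ∈-row q
  ... | refl , lt = lt

  ∈-pairs⁺ : ∀ {a b : Fin n} → a Fin.< b → (a , b) ∈ pairs n
  ∈-pairs⁺ {n} {a} {b} a<b = ∈-concatMap⁺ (row n) (Any.map (λ { refl →
    ∈-map⁺ (a ,_) (∈-filter⁺ (λ j → a Fin.<? j) (∈-allFin b) a<b) }) (∈-allFin a))

  pairs-unique : ∀ n → Unique (pairs n)
  pairs-unique n = Unique.concat⁺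
    (All.map⁺ (All.tabulate (λ {i} _ → Unique.map⁺ ,-injectiveʳ (Unique.filter⁺ (λ j → i Fin.<? j) (Unique.allFin⁺ n)))))
    (AllPairs.map⁺ (AllPairs.map (λ { i≢j (p∈ , q∈) → i≢j (trans (sym (proj₁ (∈-row p∈))) (proj₁ (∈-row q∈))) })
      (Unique.allFin⁺ n)))

  unique-lookup-injective : ∀ {a} {A : Set a} {xs : List A} → Unique xs →
    ∀ i j → List.lookup xs i ≡ List.lookup xs j → i ≡ j
  unique-lookup-injective (_   ∷ u) zero    zero    eq = refl
  unique-lookup-injective (x∉  ∷ u) zero    (suc j) eq = contradiction eq (All.lookup x∉ (∈-lookup j))
  unique-lookup-injective (x∉  ∷ u) (suc i) zero    eq = contradiction (sym eq) (All.lookup x∉ (∈-lookup i))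
  unique-lookup-injective (_   ∷ u) (suc i) (suc j) eq = cong suc (unique-lookup-injective u i j eq)

  -- `pairs n` has no duplicates and lists each edge in increasing order only, so no second entry
  -- contributes to the disjunction in `adj`.
  adj-at : ∀ (g : Graph n) e → adj {n} g (proj₁ (List.lookup (pairs n) e)) (proj₂ (List.lookup (pairs n) e)) ≡ lookup g e
  adj-at {n} g e = adjOn-at (pairs n) e (joins-refl (proj₁ p) (proj₂ p)) others
    where
    p = List.lookup (pairs n) e
    others : ∀ e′ → e′ ≢ e → joins (proj₁ p) (proj₂ p) (List.lookup (pairs n) e′) ≡ false
    others e′ ne with joins (proj₁ p) (proj₂ p) (List.lookup (pairs n) e′) in eq
    ... | false = refl
    ... | true with joins⇒ (List.lookup (pairs n) e′) eq
    ...   | inj₁ same = contradiction (unique-lookup-injective (pairs-unique n) e′ e same) ne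
    ...   | inj₂ swapped = contradiction
      (∈-pairs⁻ (subst (_∈ pairs n) swapped (∈-lookup e′)))
      (Fin.<-asym (∈-pairs⁻ (∈-lookup {xs = pairs n} e)))

  adj-injective : ∀ (g g′ : Graph n) → (∀ i j → adj {n} g i j ≡ adj {n} g′ i j) → g ≡ g′
  adj-injective {n} g g′ h = trans (sym (tabulate∘lookup g)) (trans (tabulate-cong (λ e →
    trans (sym (adj-at {n} g e)) (trans (h _ _) (adj-at {n} g′ e)))) (tabulate∘lookup g′))

  -- A pair in L stands for an unordered edge, which adj takes in either order.
  edge-bound : ∀ {ℓ} {P : Pred (Graph n) ℓ} (P? : Decidable P) (L : List (Fin n × Fin n)) → Unique L →
    (∀ {v r} → (v , r) ∈ L → v ≢ r × ¬ (r , v) ∈ L) →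
    (∀ {g g′} → P g → P g′ → (∀ i j → ¬ (i , j) ∈ L → ¬ (j , i) ∈ L → adj {n} g i j ≡ adj {n} g′ i j) →
      ∀ {v r} → (v , r) ∈ L → adj {n} g v r ≡ adj {n} g′ v r) →
    length (filter P? (vecs bits (length (pairs n)))) * 2 ^ length L ≤ 2 ^ length (pairs n)
  edge-bound {n} {P = P} P? L L! oriented forced = begin
    length (filter P? (vecs bits (length (pairs n)))) * 2 ^ length L
      ≤⟨ *-mono-≤ (determined-bound (pairs n) D? P? det) (^-monoʳ-≤ 2 L≤) ⟩
    2 ^ length (filter (¬? ∘ D?) (pairs n)) * 2 ^ length (filter D? (pairs n))
      ≡⟨ ^-distribˡ-+-* 2 (length (filter (¬? ∘ D?) (pairs n))) _ ⟨
    2 ^ (length (filter (¬? ∘ D?) (pairs n)) + length (filter D? (pairs n)))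
      ≡⟨ cong (2 ^_) (trans (+-comm (length (filter (¬? ∘ D?) (pairs n))) _) (length-filter-∁ D? (pairs n))) ⟩
    2 ^ length (pairs n) ∎
    where
    open ≤-Reasoning
    swap : Fin n × Fin n → Fin n × Fin n
    swap (a , b) = b , a
    D : Pred (Fin n × Fin n) _
    D p = p ∈ L ⊎ swap p ∈ L
    mem? : Decidable (_∈ L)
    mem? p = Any.any? (≡-dec Fin._≟_ Fin._≟_ p) L
    D? : Decidable D
    D? p = mem? p ⊎-dec mem? (swap p)
    -- `pairs n` knows only the increasing order. Sorting is injective on `L` because `L` never
    -- contains both orders of an edge.
    sort : Fin n × Fin n → Fin n × Fin n
    sort (v , r) with v Fin.<? r
    ... | yes _ = v , r
    ... | no  _ = r , v
    sort-cases : ∀ q → sort q ≡ q ⊎ sort q ≡ swap q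
    sort-cases (v , r) with v Fin.<? r
    ... | yes _ = inj₁ refl
    ... | no  _ = inj₂ refl
    sort-injective : ∀ {q q′} → q ∈ L → q′ ∈ L → sort q ≡ sort q′ → q ≡ q′
    sort-injective {q} {q′} q∈ q′∈ eq with sort-cases q | sort-cases q′
    ... | inj₁ s | inj₁ s′ = trans (sym s) (trans eq s′)
    ... | inj₂ s | inj₂ s′ = cong swap (trans (sym s) (trans eq s′))
    ... | inj₁ s | inj₂ s′ = contradiction (subst (_∈ L) (trans (sym s) (trans eq s′)) q∈) (proj₂ (oriented q′∈))
    ... | inj₂ s | inj₁ s′ = contradiction (subst (_∈ L) (trans (sym s′) (trans (sym eq) s)) q′∈) (proj₂ (oriented q∈))
    sort∈ : ∀ {q} → q ∈ L → sort q ∈ filter D? (pairs n)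
    sort∈ {v , r} q∈ with v Fin.<? r
    ... | yes v<r = ∈-filter⁺ D? (∈-pairs⁺ v<r) (inj₁ q∈)
    ... | no ¬v<r with Fin.<-cmp v r
    ...   | tri< v<r _ _ = contradiction v<r ¬v<r
    ...   | tri≈ _ eq _  = contradiction eq (proj₁ (oriented q∈))
    ...   | tri> _ _ r<v = ∈-filter⁺ D? (∈-pairs⁺ r<v) (inj₂ q∈)
    L≤ : length L ≤ length (filter D? (pairs n))
    L≤ = injective-length sort L! sort-injective sort∈
    adj-sym : ∀ (g : Graph n) i j → adj {n} g i j ≡ adj {n} g j i
    adj-sym g i j = go (pairs n) g
      where
      go : ∀ ps (g : Vec Bool (length ps)) → adjOn ps g i j ≡ adjOn ps g j i
      go []       []      = refl
      go (p ∷ ps) (b ∷ g) = cong₂ _∨_ (cong (b ∧_) (∨-comm (does (proj₁ p Fin.≟ i) ∧ does (proj₂ p Fin.≟ j)) _)) (go ps g)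
    det : ∀ {g g′} → P g → P g′ → (∀ e → ¬ D (List.lookup (pairs n) e) → lookup g e ≡ lookup g′ e) → g ≡ g′
    det {g} {g′} pg pg′ h = adj-injective {n} g g′ all
      where
      free : ∀ i j → ¬ (i , j) ∈ L → ¬ (j , i) ∈ L → adj {n} g i j ≡ adj {n} g′ i j
      free i j ∉₁ ∉₂ = adjOn-cong (pairs n) (λ e m → h e (λ d → out (joins⇒ (List.lookup (pairs n) e) m) d))
        where
        out : ∀ {p} → p ≡ (i , j) ⊎ p ≡ (j , i) → ¬ D p
        out (inj₁ refl) (inj₁ d) = ∉₁ d
        out (inj₁ refl) (inj₂ d) = ∉₂ d
        out (inj₂ refl) (inj₁ d) = ∉₂ d
        out (inj₂ refl) (inj₂ d) = ∉₁ d
      all : ∀ i j → adj {n} g i j ≡ adj {n} g′ i j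
      all i j with mem? (i , j) | mem? (j , i)
      ... | yes p | _     = forced pg pg′ free p
      ... | no _  | yes p = trans (adj-sym g i j) (trans (forced pg pg′ free p) (adj-sym g′ j i))
      ... | no ∉₁ | no ∉₂ = free i j ∉₁ ∉₂

open Edges

-- Integer congruences, and partitions that are equitable modulo a number.

module Equitability where

  open import Data.Nat as ℕ using (ℕ; zero; suc; _^_)
  import Data.Nat.Properties as ℕ
  import Data.Nat.Divisibility as ℕ
  open import Data.Integer as ℤ
    using (ℤ; +_; 0ℤ; 1ℤ; _+_; _*_; _-_; -_; ∣_∣)
  import Data.Integer.Properties as ℤ
  open import Data.Integer.Divisibility.Signed
  open import Data.Integer.Tactic.RingSolver using (solve-∀)
  open import Algebra.Properties.Semiring.Sum ℤ.+-*-semiring using (sum; sum-cong-≗)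
  open import Relation.Binary.PropositionalEquality

  infix 4 _≡_[mod_]
  -- A record and not a synonym, so that both sides can be inferred: they cannot be read off from
  -- the normal form of `a - b`.
  record _≡_[mod_] (a b p : ℤ) : Set where
    constructor ∣-difference
    field difference : p ∣ a - b
  open _≡_[mod_] public

  abstract
    _≡?_[mod_] : ∀ a b p → Dec (a ≡ b [mod p ])
    a ≡? b [mod p ] = Dec.map′ ∣-difference difference (p ∣? a - b)

  mod-refl : ∀ {p a} → a ≡ a [mod p ]
  mod-refl {a = a} = ∣-difference (divides 0ℤ (ℤ.+-inverseʳ a))

  mod-reflexive : ∀ {p a b} → a ≡ b → a ≡ b [mod p ]
  mod-reflexive refl = mod-refl

  mod-sym : ∀ {p a b} → a ≡ b [mod p ] → b ≡ a [mod p ]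
  mod-sym {p} {a} {b} (∣-difference h) = ∣-difference (subst (p ∣_) (flip a b) (∣m⇒∣-m h))
    where
    flip : ∀ a b → - (a - b) ≡ b - a
    flip = solve-∀

  mod-trans : ∀ {p a b c} → a ≡ b [mod p ] → b ≡ c [mod p ] → a ≡ c [mod p ]
  mod-trans {p} {a} {b} {c} (∣-difference h) (∣-difference k) =
    ∣-difference (subst (p ∣_) (telescope a b c) (∣m∣n⇒∣m+n h k))
    where
    telescope : ∀ a b c → (a - b) + (b - c) ≡ a - c
    telescope = solve-∀

  mod-+ : ∀ {p a b c d} → a ≡ b [mod p ] → c ≡ d [mod p ] → a + c ≡ b + d [mod p ]
  mod-+ {p} {a} {b} {c} {d} (∣-difference h) (∣-difference k) =
    ∣-difference (subst (p ∣_) (regroup a b c d) (∣m∣n⇒∣m+n h k))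
    where
    regroup : ∀ a b c d → (a - b) + (c - d) ≡ (a + c) - (b + d)
    regroup = solve-∀

  mod-* : ∀ {p a b c d} → a ≡ b [mod p ] → c ≡ d [mod p ] → a * c ≡ b * d [mod p ]
  mod-* {p} {a} {b} {c} {d} (∣-difference h) (∣-difference k) =
    ∣-difference (subst (p ∣_) (regroup a b c d) (∣m∣n⇒∣m+n (∣n⇒∣m*n c h) (∣n⇒∣m*n b k)))
    where
    regroup : ∀ a b c d → c * (a - b) + b * (c - d) ≡ a * c - b * d
    regroup = solve-∀

  mod-sum : ∀ {p} {f g : Fin n → ℤ} → (∀ w → f w ≡ g w [mod p ]) → sum f ≡ sum g [mod p ]
  mod-sum {zero}  h = mod-refl
  mod-sum {suc n} h = mod-+ (h zero) (mod-sum (h ∘ suc))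

  𝟙 : Bool → ℤ
  𝟙 true  = 1ℤ
  𝟙 false = 0ℤ

  -- Writing the modulus as `suc (suc q)` makes it at least 2, which keeps 0 and 1 apart.
  𝟙-injective-mod : ∀ {q} b b′ → 𝟙 b ≡ 𝟙 b′ [mod + suc (suc q) ] → b ≡ b′
  𝟙-injective-mod false false h = refl
  𝟙-injective-mod true  true  h = refl
  𝟙-injective-mod false true  (∣-difference h) = contradiction (ℕ.∣1⇒≡1 (∣⇒∣ᵤ h)) λ ()
  𝟙-injective-mod true  false (∣-difference h) = contradiction (ℕ.∣1⇒≡1 (∣⇒∣ᵤ h)) λ ()

  -- Isolates the one edge bit of a class degree that is not yet known to agree in two graphs.
  sum-differ : ∀ (f g : Fin n → ℤ) r → (∀ w → w ≢ r → f w ≡ g w) → sum f - sum g ≡ f r - g r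
  sum-differ {suc n} f g zero    h =
    trans (cong (λ s → f zero + sum (f ∘ suc) - (g zero + s)) (sum-cong-≗ (λ w → sym (h (suc w) λ ()))))
          (cancelʳ (f zero) (g zero) (sum (f ∘ suc)))
    where
    cancelʳ : ∀ a b s → a + s - (b + s) ≡ a - b
    cancelʳ = solve-∀
  sum-differ {suc n} f g (suc r) h =
    trans (cong (λ s → f zero + sum (f ∘ suc) - (s + sum (g ∘ suc))) (sym (h zero λ ())))
    (trans (cancelˡ (f zero) (sum (f ∘ suc)) (sum (g ∘ suc)))
           (sum-differ (f ∘ suc) (g ∘ suc) r (λ w ne → h (suc w) (ne ∘ Fin.suc-injective))))
    where
    cancelˡ : ∀ a s t → a + s - (a + t) ≡ s - t
    cancelˡ = solve-∀

  -- For an adjacency matrix and a representative `c`, this is the degree of `u` into the class of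
  -- `c`.
  weightInto : (Fin n → Fin n → ℤ) → (Fin n → Fin n) → Fin n → Fin n → ℤ
  weightInto A ρ u c = sum (λ w → A u w * 𝟙 (does (ρ w Fin.≟ c)))

  -- The partition of the indices into the fibres of ρ is equitable modulo q + 2;
  -- ρ is meant to send every index to a representative of its class.
  Equitable : ℕ → (Fin n → Fin n → ℤ) → (Fin n → Fin n) → Set
  Equitable q A ρ = ∀ u r → weightInto A ρ u (ρ r) ≡ weightInto A ρ (ρ u) (ρ r) [mod + suc (suc q) ]

  adjacency : Graph n → Fin n → Fin n → ℤ
  adjacency {n} g u w = 𝟙 (adj {n} g u w)

  abstract
    equitable? : ∀ q A (ρ : Fin n → Fin n) → Dec (Equitable q A ρ)
    equitable? q A ρ = Fin.all? λ u → Fin.all? λ r → _ ≡? _ [mod _ ]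

  -- The bit of the edge v r is recovered from the class degrees into the class of r
  -- of v and of a partner π in the same class as v.
  equitable-bound : ∀ q (ρ : Fin n → Fin n) (L : List (Fin n × Fin n)) → Unique L →
    (∀ {v r} → (v , r) ∈ L → ρ r ≡ r × v ≢ r × ¬ (r , v) ∈ L × (∃[ π ] ρ π ≡ ρ v ×
      (∀ w → ρ w ≡ r → ¬ (π , w) ∈ L × ¬ (w , π) ∈ L)) ×
      (∀ w → ρ w ≡ r → w ≢ r → ¬ (v , w) ∈ L × ¬ (w , v) ∈ L)) →
    length (filter (λ g → equitable? q (adjacency {n} g) ρ) (vecs bits (length (pairs n))))
      ℕ.* 2 ^ length L ℕ.≤ 2 ^ length (pairs n)
  equitable-bound {n} q ρ L L! ok = edge-bound {n} (λ g → equitable? q (adjacency {n} g) ρ) L L!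
    (λ l → let _ , v≢r , ∉ , _ = ok l in v≢r , ∉) forced
    where
    forced : ∀ {g g′} → Equitable q (adjacency {n} g) ρ → Equitable q (adjacency {n} g′) ρ →
      (∀ i j → ¬ (i , j) ∈ L → ¬ (j , i) ∈ L → adj {n} g i j ≡ adj {n} g′ i j) →
      ∀ {v r} → (v , r) ∈ L → adj {n} g v r ≡ adj {n} g′ v r
    forced {g} {g′} eg eg′ free {v} {r} l with ok l
    -- The degree of `v` into the class of `r` is congruent to that of `π`, which is the same in `g`
    -- and `g′` since no edge from `π` into that class is in `L`. All terms for `v` except the one
    -- at `r` agree too, so the two bits at `r` are congruent, hence equal.
    ... | ρr≡r , _ , _ , (π , ρπ≡ρv , π-free) , v-free = 𝟙-injective-mod _ _ (∣-difference (subst (p ∣_)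
        (trans (sum-differ (term g v) (term g′ v) r (λ w ne → v-terms w ne))
          (cong₂ _-_ (at-r g) (at-r g′)))
        (difference (mod-trans (partner g eg)
          (mod-trans (mod-reflexive (sum-cong-≗ π-terms)) (mod-sym (partner g′ eg′)))))))
      where
      p = + suc (suc q)
      d : Graph n → Fin n → ℤ
      d g u = weightInto (adjacency {n} g) ρ u r
      term : Graph n → Fin n → Fin n → ℤ
      term g u w = 𝟙 (adj {n} g u w) * 𝟙 (does (ρ w Fin.≟ r))
      to-rep : ∀ g → Equitable q (adjacency {n} g) ρ → ∀ u → d g u ≡ d g (ρ u) [mod p ]
      to-rep g eg u = subst
        (λ c → weightInto (adjacency {n} g) ρ u c ≡ weightInto (adjacency {n} g) ρ (ρ u) c [mod p ]) ρr≡r (eg u r)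
      partner : ∀ g → Equitable q (adjacency {n} g) ρ → d g v ≡ d g π [mod p ]
      partner g eg = mod-trans (to-rep g eg v)
        (mod-sym (subst (λ z → d g π ≡ d g z [mod p ]) ρπ≡ρv (to-rep g eg π)))
      π-terms : ∀ w → term g π w ≡ term g′ π w
      π-terms w with ρ w Fin.≟ r
      ... | no  _  = trans (ℤ.*-zeroʳ (𝟙 (adj {n} g π w))) (sym (ℤ.*-zeroʳ (𝟙 (adj {n} g′ π w))))
      ... | yes ρw = cong (λ b → 𝟙 b * 1ℤ) (free π w (proj₁ (π-free w ρw)) (proj₂ (π-free w ρw)))
      v-terms : ∀ w → w ≢ r → term g v w ≡ term g′ v w
      v-terms w ne with ρ w Fin.≟ r
      ... | no  _  = trans (ℤ.*-zeroʳ (𝟙 (adj {n} g v w))) (sym (ℤ.*-zeroʳ (𝟙 (adj {n} g′ v w))))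
      ... | yes ρw = cong (λ b → 𝟙 b * 1ℤ) (free v w (proj₁ (v-free w ρw ne)) (proj₂ (v-free w ρw ne)))
      at-r : ∀ g → term g v r ≡ 𝟙 (adj {n} g v r)
      at-r g rewrite dec-true (ρ r Fin.≟ r) ρr≡r = ℤ.*-identityʳ _

  -- Maps are enumerated as vectors, and `lookup (tabulate ρ)` agrees with `ρ` only pointwise.
  Equitable-cong : ∀ q A {ρ σ : Fin n → Fin n} → (∀ x → ρ x ≡ σ x) → Equitable q A ρ → Equitable q A σ
  Equitable-cong q A {ρ} {σ} h eg u r =
    subst₂ (_≡_[mod + suc (suc q) ]) (same u r) (trans (same (ρ u) r) (cong (λ z → weightInto A σ z (σ r)) (h u))) (eg u r)
    where
    same : ∀ u r → weightInto A ρ u (ρ r) ≡ weightInto A σ u (σ r)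
    same u r = sum-cong-≗ (λ w → cong₂ (λ a b → A u w * 𝟙 (does (a Fin.≟ b))) (h w) (h r))

open Equitability

-- The union bound over idempotent maps and moduli.

module UnionBound where

  open import Data.Nat
    using (ℕ; zero; suc; _+_; _*_; _∸_; _^_; _≤_; _<_; _≥_; z≤n; NonZero)
  open import Data.Nat.Properties
  open import Data.Nat.Tactic.RingSolver using (solve-∀)
  open import Relation.Binary.PropositionalEquality

  module _ (ρ : Fin n → Fin n) where

    fixed? : Decidable (λ x → ρ x ≡ x)
    fixed? x = ρ x Fin.≟ x

    moved? : Decidable (λ x → ρ x ≢ x)
    moved? x = ¬? (fixed? x)

    fixed moved : List (Fin n)
    fixed = filter fixed? (allFin n)
    moved = filter moved? (allFin n)

    fixed+moved : length fixed + length moved ≡ n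
    fixed+moved = trans (length-filter-∁ fixed? (allFin n)) (length-tabulate id)

    fixed⁻ : ∀ {x} → x ∈ fixed → ρ x ≡ x
    fixed⁻ x∈ = proj₂ (∈-filter⁻ fixed? {xs = allFin n} x∈)

    moved⁻ : ∀ {x} → x ∈ moved → ρ x ≢ x
    moved⁻ x∈ = proj₂ (∈-filter⁻ moved? {xs = allFin n} x∈)

    fixed⁺ : ∀ {x} → ρ x ≡ x → x ∈ fixed
    fixed⁺ = ∈-filter⁺ fixed? (∈-allFin _)

    fixed-unique : Unique fixed
    fixed-unique = Unique.filter⁺ fixed? (Unique.allFin⁺ n)

    moved-unique : Unique moved
    moved-unique = Unique.filter⁺ moved? (Unique.allFin⁺ n)

  module _ (q : ℕ) (ρ : Fin n → Fin n) (idem : ∀ x → ρ (ρ x) ≡ ρ x) where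

    private
      count : ℕ
      count = length (filter (λ g → equitable? q (adjacency {n} g) ρ) (vecs bits (length (pairs n))))

      Mate : Fin n → Fin n → Set
      Mate c w = ρ w ≡ c × ρ w ≢ w

      mate? : ∀ c → Dec (∃ (Mate c))
      mate? c = Fin.any? λ w → (ρ w Fin.≟ c) ×-dec moved? ρ w

      pick : ∀ {c} → Dec (∃ (Mate c)) → Fin n → Fin n
      pick (yes (w , _)) _ = w
      pick (no  _)       v = v

      -- A moved vertex of the class of v, the same one for all moved v of that class.
      mate : Fin n → Fin n
      mate v = pick (mate? (ρ v)) v

      mate-spec : ∀ v → ρ v ≢ v → Mate (ρ v) (mate v)
      mate-spec v ne with mate? (ρ v)
      ... | yes (_ , m) = m
      ... | no none     = contradiction (v , refl , ne) none

      mate-cong : ∀ {v w} → ρ v ≢ v → ρ v ≡ ρ w → mate v ≡ mate w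
      mate-cong {v} {w} ne eq rewrite sym eq with mate? (ρ v)
      ... | yes _   = refl
      ... | no none = contradiction (v , refl , ne) none

      mated? : Decidable (λ v → mate v ≡ v)
      mated? v = mate v Fin.≟ v

      spare : List (Fin n)
      spare = filter (¬? ∘ mated?) (moved ρ)

      spare⁻ : ∀ {v} → v ∈ spare → ρ v ≢ v × mate v ≢ v
      spare⁻ v∈ = let v∈m , ne = ∈-filter⁻ (¬? ∘ mated?) {xs = moved ρ} v∈ in moved⁻ ρ v∈m , ne

      -- A class contains at most one vertex that is its own mate, so `ρ` maps these vertices
      -- injectively to representatives. Removing them and the representatives costs at most `2 * m`
      -- vertices.
      spare-length : n ∸ 2 * length (fixed ρ) ≤ length spare
      spare-length = begin
        n ∸ 2 * m                           ≡⟨ cong₂ _∸_ (sym (fixed+moved ρ)) (cong (m +_) (+-identityʳ m)) ⟩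
        m + length (moved ρ) ∸ (m + m)      ≡⟨ [m+n]∸[m+o]≡n∸o m (length (moved ρ)) m ⟩
        length (moved ρ) ∸ m                ≤⟨ ∸-monoʳ-≤ (length (moved ρ)) mated≤ ⟩
        length (moved ρ) ∸ length mated     ≡⟨ cong (_∸ length mated) (sym (length-filter-∁ mated? (moved ρ))) ⟩
        length mated + length spare ∸ length mated  ≡⟨ m+n∸m≡n (length mated) _ ⟩
        length spare                        ∎
        where
        open ≤-Reasoning
        m = length (fixed ρ)
        mated = filter mated? (moved ρ)
        mated⁻ : ∀ {v} → v ∈ mated → ρ v ≢ v × mate v ≡ v
        mated⁻ v∈ = let v∈m , eq = ∈-filter⁻ mated? {xs = moved ρ} v∈ in moved⁻ ρ v∈m , eq
        mated≤ : length mated ≤ m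
        mated≤ = injective-length ρ (Unique.filter⁺ mated? (moved-unique ρ))
          (λ x∈ y∈ eq → let nx , ex = mated⁻ x∈ ; _ , ey = mated⁻ y∈ in
            trans (sym ex) (trans (mate-cong nx eq) ey))
          (λ {x} _ → fixed⁺ ρ (idem x))

    -- The determined edges join spare vertices to representatives. The representative of `v` may
    -- itself be an end of such an edge from the class of `r`, so the mate of `v` is taken as the
    -- partner: it is neither spare nor a representative.
    few-classes-bound : let m = length (fixed ρ) in
      count * 2 ^ (m * (n ∸ 2 * m)) ≤ 2 ^ length (pairs n)
    few-classes-bound = ≤-trans
      (*-monoʳ-≤ count (^-monoʳ-≤ 2 (begin
        m * (n ∸ 2 * m)      ≡⟨ *-comm m _ ⟩
        (n ∸ 2 * m) * m      ≤⟨ *-monoˡ-≤ m spare-length ⟩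
        length spare * m     ≡⟨ length-cartesianProductWith _,_ spare (fixed ρ) ⟨
        length L             ∎)))
      (equitable-bound {n} q ρ L
        (Unique.cartesianProduct⁺ (Unique.filter⁺ (¬? ∘ mated?) (moved-unique ρ)) (fixed-unique ρ)) ok)
      where
      open ≤-Reasoning
      m = length (fixed ρ)
      L = cartesianProduct spare (fixed ρ)
      L⁻ : ∀ {v r} → (v , r) ∈ L → (ρ v ≢ v × mate v ≢ v) × ρ r ≡ r
      L⁻ l = let v∈ , r∈ = ∈-cartesianProduct⁻ spare (fixed ρ) l in spare⁻ v∈ , fixed⁻ ρ r∈
      ok : ∀ {v r} → (v , r) ∈ L → ρ r ≡ r × v ≢ r × ¬ (r , v) ∈ L × (∃[ π ] ρ π ≡ ρ v ×
        (∀ w → ρ w ≡ r → ¬ (π , w) ∈ L × ¬ (w , π) ∈ L)) ×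
        (∀ w → ρ w ≡ r → w ≢ r → ¬ (v , w) ∈ L × ¬ (w , v) ∈ L)
      ok {v} {r} l with L⁻ l
      ... | (ρv≢v , _) , ρr≡r =
        ρr≡r , (λ { refl → ρv≢v ρr≡r }) , (λ l′ → ρv≢v (proj₂ (L⁻ l′))) ,
        (mate v , ρm , λ w _ →
          (λ l′ → proj₂ (proj₁ (L⁻ l′)) (sym (mate-cong ρv≢v (sym ρm)))) ,
          (λ l′ → m≢ (proj₂ (L⁻ l′)))) ,
        λ w ρw≡r w≢r → (λ l′ → w≢r (trans (sym (proj₂ (L⁻ l′))) ρw≡r)) , (λ l′ → ρv≢v (proj₂ (L⁻ l′)))
        where
        ρm : ρ (mate v) ≡ ρ v
        ρm = proj₁ (mate-spec v ρv≢v)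
        m≢ : ρ (mate v) ≢ mate v
        m≢ = proj₂ (mate-spec v ρv≢v)

    private
      all-pairs : List (Fin n × Fin n)
      all-pairs = cartesianProduct (moved ρ) (fixed ρ)

      all-pairs-unique : Unique all-pairs
      all-pairs-unique = Unique.cartesianProduct⁺ (moved-unique ρ) (fixed-unique ρ)

      -- The asymmetric relation _⊏_ between classes decides which end of a pair of classes
      -- supplies the determined edges.
      module Oriented {_⊏_ : Fin n → Fin n → Set} (_⊏?_ : ∀ x y → Dec (x ⊏ y))
        (asym : ∀ {x y} → x ⊏ y → ¬ y ⊏ x) where

        select? : Decidable (λ ((v , r) : Fin n × Fin n) → ρ v ⊏ r)
        select? (v , r) = ρ v ⊏? r

        L : List (Fin n × Fin n)
        L = filter select? all-pairs

        L⁻ : ∀ {v r} → (v , r) ∈ L → ρ v ≢ v × ρ r ≡ r × ρ v ⊏ r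
        L⁻ l = let l′ , lt = ∈-filter⁻ select? {xs = all-pairs} l
                   v∈ , r∈ = ∈-cartesianProduct⁻ (moved ρ) (fixed ρ) l′
               in moved⁻ ρ v∈ , fixed⁻ ρ r∈ , lt

        -- Here the representative `ρ v` can be the partner: a pair of `L` that ends in it and
        -- starts in the class of `r` would give `r ⊏ ρ v`, against asymmetry, and no pair of `L`
        -- starts at a representative.
        bound : count * 2 ^ length L ≤ 2 ^ length (pairs n)
        bound = equitable-bound {n} q ρ L (Unique.filter⁺ select? all-pairs-unique) ok
          where
          ok : ∀ {v r} → (v , r) ∈ L → ρ r ≡ r × v ≢ r × ¬ (r , v) ∈ L × (∃[ π ] ρ π ≡ ρ v ×
            (∀ w → ρ w ≡ r → ¬ (π , w) ∈ L × ¬ (w , π) ∈ L)) ×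
            (∀ w → ρ w ≡ r → w ≢ r → ¬ (v , w) ∈ L × ¬ (w , v) ∈ L)
          ok {v} {r} l with L⁻ l
          ... | ρv≢v , ρr≡r , lt =
            ρr≡r , (λ { refl → ρv≢v ρr≡r }) , (λ l′ → ρv≢v (proj₁ (proj₂ (L⁻ l′)))) ,
            (ρ v , idem v , λ w ρw≡r →
              (λ l′ → proj₁ (L⁻ l′) (idem v)) ,
              (λ l′ → asym lt (subst (_⊏ ρ v) ρw≡r (proj₂ (proj₂ (L⁻ l′)))))) ,
            λ w ρw≡r w≢r → (λ l′ → w≢r (trans (sym (proj₁ (proj₂ (L⁻ l′)))) ρw≡r)) ,
                            (λ l′ → ρv≢v (proj₁ (proj₂ (L⁻ l′))))

      module Up   = Oriented Fin._<?_ Fin.<-asym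
      module Down = Oriented {λ x y → y Fin.< x} (λ x y → y Fin.<? x) (λ p q → Fin.<-asym p q)

    -- Of the pairs of a moved vertex and a representative, only those with `r = ρ v` belong to
    -- neither orientation, one for each moved vertex. Under the hypothesis, one of the two
    -- orientations therefore has at least `d` pairs.
    many-classes-bound : ∀ d → 2 * d + length (moved ρ) ≤ length (moved ρ) * length (fixed ρ) →
      count * 2 ^ d ≤ 2 ^ length (pairs n)
    many-classes-bound d h with d ≤? length Up.L | d ≤? length Down.L
    ... | yes d≤ | _      = ≤-trans (*-monoʳ-≤ count (^-monoʳ-≤ 2 d≤)) Up.bound
    ... | no _   | yes d≤ = ≤-trans (*-monoʳ-≤ count (^-monoʳ-≤ 2 d≤)) Down.bound
    ... | no ¬u  | no ¬d  = contradiction h (<⇒≱ (begin-strict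
        k * m                                   ≡⟨ length-cartesianProductWith _,_ (moved ρ) (fixed ρ) ⟨
        length all-pairs                        ≡⟨ length-filter-∁ Up.select? all-pairs ⟨
        length Up.L + length rest               ≡⟨ cong (length Up.L +_) (length-filter-∁ Down.select? rest) ⟨
        length Up.L + (length (filter Down.select? rest) + length diag)
          ≤⟨ +-monoʳ-≤ (length Up.L) (+-mono-≤ down≤ diag≤) ⟩
        length Up.L + (length Down.L + k)       <⟨ +-monoˡ-< _ (≰⇒> ¬u) ⟩
        d + (length Down.L + k)                 ≤⟨ +-monoʳ-≤ d (+-monoˡ-≤ k (<⇒≤ (≰⇒> ¬d))) ⟩
        d + (d + k)                             ≡⟨ +-assoc d d k ⟨
        d + d + k                               ≡⟨ cong (λ z → d + z + k) (+-identityʳ d) ⟨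
        2 * d + k                               ∎))
      where
      open ≤-Reasoning
      k = length (moved ρ)
      m = length (fixed ρ)
      rest = filter (¬? ∘ Up.select?) all-pairs
      rest-unique : Unique rest
      rest-unique = Unique.filter⁺ (¬? ∘ Up.select?) all-pairs-unique
      rest⁻ : ∀ {p} → p ∈ rest → p ∈ all-pairs × ¬ ρ (proj₁ p) Fin.< proj₂ p
      rest⁻ p∈ = ∈-filter⁻ (¬? ∘ Up.select?) {xs = all-pairs} p∈
      diag = filter (¬? ∘ Down.select?) rest
      down≤ : length (filter Down.select? rest) ≤ length Down.L
      down≤ = unique-⊆-length (Unique.filter⁺ Down.select? rest-unique)
        (λ p∈ → let p∈r , s = ∈-filter⁻ Down.select? {xs = rest} p∈ in
          ∈-filter⁺ Down.select? (proj₁ (rest⁻ p∈r)) s)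
      diag⁻ : ∀ {v r} → (v , r) ∈ diag → v ∈ moved ρ × ρ v ≡ r
      diag⁻ {v} {r} p∈ with ∈-filter⁻ (¬? ∘ Down.select?) {xs = rest} p∈
      ... | p∈r , ¬> with rest⁻ p∈r
      ...   | p∈a , ¬< with Fin.<-cmp (ρ v) r
      ...     | tri< lt _ _ = contradiction lt ¬<
      ...     | tri> _ _ gt = contradiction gt ¬>
      ...     | tri≈ _ eq _ = proj₁ (∈-cartesianProduct⁻ (moved ρ) (fixed ρ) p∈a) , eq
      diag≤ : length diag ≤ k
      diag≤ = injective-length proj₁ (Unique.filter⁺ (¬? ∘ Down.select?) rest-unique)
        (λ { {v , r} {v′ , r′} p∈ q∈ refl → cong (v ,_) (trans (sym (proj₂ (diag⁻ p∈))) (proj₂ (diag⁻ q∈))) })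
        (λ p∈ → proj₁ (diag⁻ p∈))

  Idempotent : (Fin n → Fin n) → Set
  Idempotent ρ = ∀ x → ρ (ρ x) ≡ ρ x

  idempotent? : Decidable (Idempotent {n})
  idempotent? ρ = Fin.all? λ x → ρ (ρ x) Fin.≟ ρ x

  vec-ext : ∀ {a : Level} {A : Set a} {v w : Vec A n} → (∀ i → lookup v i ≡ lookup w i) → v ≡ w
  vec-ext {v = v} {w} h = trans (sym (tabulate∘lookup v)) (trans (tabulate-cong h) (tabulate∘lookup w))

  lookup-fromList : ∀ {a : Level} {A : Set a} (xs : List A) i → lookup (fromList xs) i ≡ List.lookup xs i
  lookup-fromList (x ∷ xs) zero    = refl
  lookup-fromList (x ∷ xs) (suc i) = lookup-fromList xs i

  -- An idempotent map with `m` fixed points factors through `Fin m`. Repetitions and maps that are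
  -- not idempotent are harmless in an upper bound.
  factoring : (n m : ℕ) → List (Vec (Fin n) n)
  factoring n m =
    map (λ (r , f) → Vec.map (lookup r) f) (cartesianProduct (vecs (allFin n) m) (vecs (allFin m) n))

  length-factoring : ∀ n m → length (factoring n m) ≡ n ^ m * m ^ n
  length-factoring n m = trans (length-map _ (cartesianProduct (vecs (allFin n) m) (vecs (allFin m) n)))
    (trans (length-cartesianProductWith _,_ (vecs (allFin n) m) (vecs (allFin m) n))
      (cong₂ _*_ (trans (length-vecs (allFin n) m) (cong (_^ m) (length-tabulate id)))
                 (trans (length-vecs (allFin m) n) (cong (_^ n) (length-tabulate id)))))

  ∈-factoring : ∀ (v : Vec (Fin n) n) → Idempotent (lookup v) → v ∈ factoring n (length (fixed (lookup v)))
  ∈-factoring {n} v idem = subst (_∈ factoring n (length R)) (vec-ext same)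
    (∈-map⁺ (λ (r , f) → Vec.map (lookup r) f)
      (∈-cartesianProduct⁺ (∈-vecs r (λ _ → ∈-allFin _)) (∈-vecs f (λ _ → ∈-allFin _))))
    where
    R = fixed (lookup v)
    v∈R : ∀ x → lookup v x ∈ R
    v∈R x = fixed⁺ (lookup v) (idem x)
    r = fromList R
    f = tabulate (λ x → Any.index (v∈R x))
    same : ∀ i → lookup (Vec.map (lookup r) f) i ≡ lookup v i
    same i = trans (lookup-map i (lookup r) f) (trans (cong (lookup r) (lookup∘tabulate _ i))
      (trans (lookup-fromList R _) (sym (Any.lookup-index (v∈R i)))))

  -- The identity with `k` entries overwritten. For `m` near `n` this encoding of a map by its moved
  -- points is much cheaper than `factoring`.
  moves : ∀ {k} → Vec (Fin n × Fin n) k → Vec (Fin n) n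
  moves []            = tabulate id
  moves ((x , y) ∷ ps) = moves ps [ x ]≔ y

  moving : (n k : ℕ) → List (Vec (Fin n) n)
  moving n k = map moves (vecs (cartesianProduct (allFin n) (allFin n)) k)

  length-moving : ∀ n k → length (moving n k) ≡ (n * n) ^ k
  length-moving n k = trans (length-map moves (vecs nn k)) (trans (length-vecs nn k)
    (cong (_^ k) (trans (length-cartesianProductWith _,_ (allFin n) (allFin n))
      (cong₂ _*_ (length-tabulate {n = n} id) (length-tabulate {n = n} id)))))
    where nn = cartesianProduct (allFin n) (allFin n)

  ∈-moving : ∀ (v : Vec (Fin n) n) → v ∈ moving n (length (moved (lookup v)))
  ∈-moving {n} v = subst (_∈ moving n (length N)) (vec-ext λ x → same N x (moved-or-fixed x))
    (∈-map⁺ moves (∈-vecs (code N) (λ i → ∈-cartesianProduct⁺ (∈-allFin _) (∈-allFin _))))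
    where
    N = moved (lookup v)
    code : ∀ xs → Vec (Fin n × Fin n) (length xs)
    code xs = Vec.map (λ x → x , lookup v x) (fromList xs)
    moved-or-fixed : ∀ x → x ∈ N ⊎ lookup v x ≡ x
    moved-or-fixed x with lookup v x Fin.≟ x
    ... | yes eq = inj₂ eq
    ... | no ne  = inj₁ (∈-filter⁺ (moved? (lookup v)) (∈-allFin x) ne)
    same : ∀ xs x → x ∈ xs ⊎ lookup v x ≡ x → lookup (moves (code xs)) x ≡ lookup v x
    same []       x (inj₂ eq) = trans (lookup∘tabulate id x) (sym eq)
    same (y ∷ xs) x h with x Fin.≟ y
    ... | yes refl = lookup∘update x (moves (code xs)) (lookup v x)
    ... | no x≢y   = trans (lookup∘update′ x≢y (moves (code xs)) (lookup v y)) (same xs x (drop h))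
      where
      drop : x ∈ y ∷ xs ⊎ lookup v x ≡ x → x ∈ xs ⊎ lookup v x ≡ x
      drop (inj₁ (here eq))  = contradiction eq x≢y
      drop (inj₁ (there x∈)) = inj₁ x∈
      drop (inj₂ eq)         = inj₂ eq

  -- The restriction `q < n` leaves finitely many events for the union bound; larger moduli are
  -- recovered in `rigid⇒inequitable`.
  Rigid : Graph n → Set
  Rigid {n} g = ∀ (ρ : Fin n → Fin n) → Idempotent ρ → ∃ (λ u → ρ u ≢ u) →
    ∀ q → q < n → ¬ Equitable q (adjacency {n} g) ρ

  -- For each number `m` of classes, the gain from determined edges has to beat the number of maps
  -- times `n * (n * suc K)`: one factor `n` for the moduli, one for the values of `m`, and `suc K`
  -- for the failure probability that is aimed at.
  module _ (n : ℕ) .{{_ : NonZero n}} (K : ℕ)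
    (small : ∀ m → m < n →
      (n ^ m * m ^ n * (n * (n * suc K)) ≤ 2 ^ (m * (n ∸ 2 * m))) ⊎
      (∃[ d ] 2 * d + (n ∸ m) ≤ (n ∸ m) * m × (n * n) ^ (n ∸ m) * (n * (n * suc K)) ≤ 2 ^ d)) where

    private
      graphs : List (Graph n)
      graphs = vecs bits (length (pairs n))

      T : ℕ
      T = 2 ^ length (pairs n)

      Z : ℕ
      Z = n * suc K

      Flaw : ℕ → ℕ × Vec (Fin n) n → Graph n → Set
      Flaw m (q , v) g = (Idempotent (lookup v) × length (fixed (lookup v)) ≡ m) × Equitable q (adjacency {n} g) (lookup v)

      valid? : ∀ m (v : Vec (Fin n) n) → Dec (Idempotent (lookup v) × length (fixed (lookup v)) ≡ m)
      valid? m v = idempotent? (lookup v) ×-dec (length (fixed (lookup v)) ≟ m)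

      flaw? : ∀ m c → Decidable (Flaw m c)
      flaw? m (q , v) g = valid? m v ×-dec equitable? q (adjacency {n} g) (lookup v)

      moved≡ : ∀ {m} (ρ : Fin n → Fin n) → length (fixed ρ) ≡ m → length (moved ρ) ≡ n ∸ m
      moved≡ ρ refl = trans (sym (m+n∸m≡n (length (fixed ρ)) _)) (cong (_∸ length (fixed ρ)) (fixed+moved ρ))

      -- Validity of `v` is part of `Flaw`, so an invalid `v` has no flawed graphs and the
      -- enumerations may contain such maps.
      flaw-bound : ∀ {m W} → (∀ q ρ → Idempotent ρ → length (fixed ρ) ≡ m →
          length (filter (λ g → equitable? q (adjacency {n} g) ρ) graphs) * W ≤ T) →
        ∀ c → length (filter (flaw? m c) graphs) * W ≤ T
      flaw-bound {m} {W} h (q , v) = split (valid? m v)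
        where
        split : Dec (Idempotent (lookup v) × length (fixed (lookup v)) ≡ m) →
          length (filter (flaw? m (q , v)) graphs) * W ≤ T
        split (yes (idem , eq)) = ≤-trans
          (*-monoˡ-≤ W (length-filter-⊆ (flaw? m (q , v)) (λ g → equitable? q (adjacency {n} g) (lookup v)) proj₂ graphs))
          (h q (lookup v) idem eq)
        split (no ¬valid) = ≤-trans (≤-reflexive (cong (λ xs → length xs * W)
          (filter-none (flaw? m (q , v)) {xs = graphs} (All.tabulate (λ _ f → ¬valid (proj₁ f)))))) z≤n

      -- A common interface to the two ranges of `m`. Equitability for one given map and modulus has
      -- probability at most 2 to the power of minus `weight`.
      record Scheme (m : ℕ) : Set where
        field
          maps     : List (Vec (Fin n) n)
          complete : ∀ v → Idempotent (lookup v) × length (fixed (lookup v)) ≡ m → v ∈ maps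
          weight   : ℕ
          cost     : length maps * (n * Z) ≤ 2 ^ weight
          gain     : ∀ q ρ → Idempotent ρ → length (fixed ρ) ≡ m →
                     length (filter (λ g → equitable? q (adjacency {n} g) ρ) graphs) * 2 ^ weight ≤ T

      level : ∀ m → m < n → Scheme m
      level m m<n with small m m<n
      ... | inj₁ h = record
        { maps     = factoring n m
        ; complete = λ { v (idem , refl) → ∈-factoring v idem }
        ; weight   = m * (n ∸ 2 * m)
        ; cost     = subst (λ z → z * (n * Z) ≤ 2 ^ (m * (n ∸ 2 * m))) (sym (length-factoring n m)) h
        ; gain     = λ { q ρ idem refl → few-classes-bound {n} q ρ idem }
        }
      ... | inj₂ (d , h , h′) = record
        { maps     = moving n (n ∸ m)
        ; complete = λ { v (_ , eq) → subst (λ k → v ∈ moving n k) (moved≡ (lookup v) eq) (∈-moving v) }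
        ; weight   = d
        ; cost     = subst (λ z → z * (n * Z) ≤ 2 ^ d) (sym (length-moving n (n ∸ m))) h′
        ; gain     = λ q ρ idem eq → many-classes-bound {n} q ρ idem d
            (subst₂ (λ k l → 2 * d + k ≤ k * l) (sym (moved≡ ρ eq)) (sym eq) h)
        }

      lvl : (i : Fin n) → Scheme (toℕ i)
      lvl i = level (toℕ i) (Fin.toℕ<n i)

      codes : Fin n → List (ℕ × Vec (Fin n) n)
      codes i = cartesianProduct (upTo n) (Scheme.maps (lvl i))

      Flawed : Fin n → Graph n → Set
      Flawed i g = Any (λ c → Flaw (toℕ i) c g) (codes i)

      flawed? : ∀ i → Decidable (Flawed i)
      flawed? i g = Any.any? (λ c → flaw? (toℕ i) c g) (codes i)

      -- There are `n * length maps` codes, each with at most a proportion 1/`W` of the graphs, and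
      -- by `cost` their number times `Z` is at most `W`.
      flawed-bound : ∀ i → length (filter (flawed? i) graphs) * Z ≤ T
      flawed-bound i = *-cancelʳ-≤ _ _ W {{m^n≢0 2 weight}} (begin
        B * Z * W                          ≡⟨ swap B Z W ⟩
        B * W * Z                          ≤⟨ *-monoˡ-≤ Z (union-bound (flaw? (toℕ i)) graphs (codes i) (flaw-bound gain)) ⟩
        length (codes i) * T * Z           ≡⟨ cong (λ l → l * T * Z) (trans (length-cartesianProductWith _,_ (upTo n) maps)
                                                (cong (_* length maps) (length-upTo n))) ⟩
        n * length maps * T * Z            ≡⟨ regroup n (length maps) T Z ⟩
        length maps * (n * Z) * T          ≤⟨ *-monoˡ-≤ T cost ⟩
        W * T                              ≡⟨ *-comm W T ⟩
        T * W                              ∎)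
        where
        open ≤-Reasoning
        open Scheme (lvl i)
        W = 2 ^ weight
        B = length (filter (flawed? i) graphs)
        swap : ∀ b z w → b * z * w ≡ b * w * z
        swap = solve-∀
        regroup : ∀ n l t z → n * l * t * z ≡ l * (n * z) * t
        regroup = solve-∀

      Bad : Graph n → Set
      Bad g = Any (λ i → Flawed i g) (allFin n)

      bad? : Decidable Bad
      bad? g = Any.any? (λ i → flawed? i g) (allFin n)

      bad-bound : length (filter bad? graphs) * suc K ≤ T
      bad-bound = *-cancelʳ-≤ _ _ n (begin
        B * suc K * n            ≡⟨ trans (*-assoc B (suc K) n) (cong (B *_) (*-comm (suc K) n)) ⟩
        B * Z                    ≤⟨ union-bound flawed? graphs (allFin n) flawed-bound ⟩
        length (allFin n) * T    ≡⟨ cong (_* T) (length-tabulate {n = n} id) ⟩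
        n * T                    ≡⟨ *-comm n T ⟩
        T * n                    ∎)
        where
        open ≤-Reasoning
        B = length (filter bad? graphs)

      ¬bad⇒rigid : ∀ g → ¬ Bad g → Rigid {n} g
      ¬bad⇒rigid g ¬bad ρ idem (u , ρu≢u) q q<n eg = ¬bad (lose (∈-allFin i) (lose c∈
        ((idem′ , sym (Fin.toℕ-fromℕ< m<n)) , Equitable-cong q (adjacency {n} g) (λ x → sym (same x)) eg)))
        where
        v = tabulate ρ
        same : ∀ x → lookup v x ≡ ρ x
        same = lookup∘tabulate ρ
        idem′ : Idempotent (lookup v)
        idem′ x = trans (same _) (trans (cong ρ (same x)) (trans (idem x) (sym (same x))))
        -- The moved vertex `u` excludes the discrete partition, so the number of classes is an
        -- element of `Fin n`.
        m<n : length (fixed (lookup v)) < n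
        m<n = subst (length (fixed (lookup v)) <_) (fixed+moved (lookup v)) (m<m+n _
          (∈-length {x = u} (∈-filter⁺ (moved? (lookup v)) (∈-allFin u) (λ e → ρu≢u (trans (sym (same u)) e)))))
        i = fromℕ< m<n
        c∈ : (q , v) ∈ codes i
        c∈ = ∈-cartesianProduct⁺ (∈-upTo⁺ q<n) (Scheme.complete (lvl i) v (idem′ , sym (Fin.toℕ-fromℕ< m<n)))

    most-graphs-rigid : ∃[ S ] Unique S × All (Rigid {n}) S × suc K * length S ≥ K * T
    most-graphs-rigid = S , Unique.filter⁺ (¬? ∘ bad?) (vecs-unique (length (pairs n)) bits-unique) ,
      All.map (λ {g} → ¬bad⇒rigid g) (All.all-filter (¬? ∘ bad?) graphs) ,
      -- Adding `T` on both sides replaces the subtraction of the bad graphs.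
      +-cancelʳ-≤ T _ _ (begin
        K * T + T                       ≡⟨ +-comm (K * T) T ⟩
        suc K * T                       ≡⟨ cong (suc K *_) (length-vecs bits (length (pairs n))) ⟨
        suc K * length graphs           ≡⟨ cong (suc K *_) (length-filter-∁ bad? graphs) ⟨
        suc K * (B + length S)          ≡⟨ *-distribˡ-+ (suc K) B (length S) ⟩
        suc K * B + suc K * length S    ≡⟨ +-comm (suc K * B) _ ⟩
        suc K * length S + suc K * B    ≡⟨ cong (suc K * length S +_) (*-comm (suc K) B) ⟩
        suc K * length S + B * suc K    ≤⟨ +-monoʳ-≤ (suc K * length S) bad-bound ⟩
        suc K * length S + T            ∎)
      where
      open ≤-Reasoning
      S = filter (¬? ∘ bad?) graphs
      B = length (filter bad? graphs)

open UnionBound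

-- Numerical estimates showing that the determined edges outweigh the maps for large n.

module Asymptotics where

  open import Data.Nat
    using (ℕ; zero; suc; _+_; _*_; _∸_; _^_; _≤_; _<_; _≥_; z≤n; s≤s; NonZero; >-nonZero)
  open import Data.Nat.Properties
  open import Data.Nat.Tactic.RingSolver using (solve-∀)
  open import Relation.Binary.PropositionalEquality

  -- The witness is the ceiling of the binary logarithm: the induction raises it only when the
  -- number outgrows `2 ^ ℓ`, which preserves the upper bound.
  binary-length : ∀ n → 1 ≤ n → ∃[ ℓ ] n ≤ 2 ^ ℓ × 2 ^ ℓ ≤ 2 * n
  binary-length 1 _ = 0 , s≤s z≤n , s≤s z≤n
  binary-length (suc (suc n)) _ with binary-length (suc n) (s≤s z≤n)
  ... | ℓ , lo , hi with suc (suc n) ≤? 2 ^ ℓ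
  ...   | yes h = ℓ , h , ≤-trans hi (*-monoʳ-≤ 2 (n≤1+n (suc n)))
  ...   | no ¬h = suc ℓ , ≤-trans (+-monoˡ-≤ (suc n) (s≤s z≤n))
                          (≤-trans (+-mono-≤ lo lo) (≤-reflexive (cong (2 ^ ℓ +_) (sym (+-identityʳ _)))))
                        , *-monoʳ-≤ 2 (<⇒≤ (≰⇒> ¬h))

  suc≤2^ : ∀ m → suc m ≤ 2 ^ m
  suc≤2^ zero    = ≤-refl
  suc≤2^ (suc m) = ≤-trans (+-mono-≤ (m^n>0 2 m) (suc≤2^ m)) (≤-reflexive (cong (2 ^ m +_) (sym (+-identityʳ _))))

  square-step : ∀ x → 3 ≤ x → suc x * suc x ≤ 2 * (x * x)
  square-step x 3≤x = begin
    suc x * suc x       ≡⟨ expand x ⟩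
    x * x + (2 * x + 1) ≤⟨ +-monoʳ-≤ (x * x) (begin
        2 * x + 1         ≤⟨ +-monoʳ-≤ (2 * x) (≤-trans (s≤s z≤n) 3≤x) ⟩
        2 * x + x         ≡⟨ triple x ⟩
        3 * x             ≤⟨ *-monoˡ-≤ x 3≤x ⟩
        x * x             ∎) ⟩
    x * x + x * x       ≡⟨ cong (x * x +_) (+-identityʳ (x * x)) ⟨
    2 * (x * x)         ∎
    where
    open ≤-Reasoning
    expand : ∀ x → suc x * suc x ≡ x * x + (2 * x + 1)
    expand = solve-∀
    triple : ∀ x → 2 * x + x ≡ 3 * x
    triple = solve-∀

  -- Here 426 is twice 213, the factor 2 making up for `2 ^ ℓ ≤ 2 * n`. Each step doubles the right
  -- side and at most doubles the left.
  quadratic≤exponential : ∀ j → 426 * ((j + 20) * (j + 20)) ≤ 2 ^ (j + 20)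
  -- The numerals are 426 · 20² and 2^20.
  quadratic≤exponential zero    = ≤ᵇ⇒≤ 170400 1048576 tt
  quadratic≤exponential (suc j) = begin
    426 * (suc x * suc x)   ≤⟨ *-monoʳ-≤ 426 (square-step x (≤-trans (s≤s (s≤s (s≤s z≤n))) (m≤n+m 20 j))) ⟩
    426 * (2 * (x * x))     ≡⟨ swap (x * x) ⟩
    2 * (426 * (x * x))     ≤⟨ *-monoʳ-≤ 2 (quadratic≤exponential j) ⟩
    2 * 2 ^ x               ∎
    where
    open ≤-Reasoning
    x = j + 20
    swap : ∀ y → 426 * (2 * y) ≡ 2 * (426 * y)
    swap = solve-∀

  abstract
    2^20 : ℕ
    2^20 = 2 ^ 20

    2^ℓ<2^20 : ∀ {ℓ} → ℓ < 20 → 2 ^ ℓ < 2^20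
    2^ℓ<2^20 = ^-monoʳ-< 2 (s≤s (s≤s z≤n))

  -- n ≥ 2^20 ensures 213 ℓ² ≤ n for ℓ = ⌈log₂ n⌉, where 213 = 10 + 3 + 200 comes from bounding
  -- ℓ m + 3 ℓ + 2 m² for m ≤ 10 ℓ.
  threshold : ℕ → ℕ
  threshold K = 2^20 + suc K

  module _ (K n : ℕ) (n≥ : n ≥ threshold K) where

    private
      K<n : suc K ≤ n
      K<n = ≤-trans (m≤n+m (suc K) 2^20) n≥

      n≥2^20 : 2^20 ≤ n
      n≥2^20 = ≤-trans (m≤m+n 2^20 (suc K)) n≥

      1≤n : 1 ≤ n
      1≤n = ≤-trans (s≤s z≤n) K<n

      ℓ : ℕ
      ℓ = proj₁ (binary-length n 1≤n)

      n≤2^ℓ : n ≤ 2 ^ ℓ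
      n≤2^ℓ = proj₁ (proj₂ (binary-length n 1≤n))

      20≤ℓ : 20 ≤ ℓ
      20≤ℓ = ≮⇒≥ (λ ℓ<20 → <⇒≱ (2^ℓ<2^20 ℓ<20) (≤-trans n≥2^20 n≤2^ℓ))

      213ℓ²≤n : 213 * (ℓ * ℓ) ≤ n
      213ℓ²≤n = *-cancelˡ-≤ 2 (begin
        2 * (213 * (ℓ * ℓ))  ≡⟨ double (ℓ * ℓ) ⟩
        426 * (ℓ * ℓ)        ≤⟨ subst (λ x → 426 * (x * x) ≤ 2 ^ x) (m∸n+n≡m 20≤ℓ) (quadratic≤exponential (ℓ ∸ 20)) ⟩
        2 ^ ℓ                ≤⟨ proj₂ (proj₂ (binary-length n 1≤n)) ⟩
        2 * n                ∎)
        where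
        open ≤-Reasoning
        double : ∀ y → 2 * (213 * y) ≡ 426 * y
        double = solve-∀

      -- The summand `suc K` of `threshold` serves this bound: all three factors are at most `n`,
      -- hence at most `2 ^ ℓ`.
      slack : n * (n * suc K) ≤ 2 ^ (3 * ℓ)
      slack = begin
        n * (n * suc K)              ≤⟨ *-mono-≤ n≤2^ℓ (*-mono-≤ n≤2^ℓ (≤-trans K<n n≤2^ℓ)) ⟩
        2 ^ ℓ * (2 ^ ℓ * 2 ^ ℓ)      ≡⟨ cong (2 ^ ℓ *_) (^-distribˡ-+-* 2 ℓ ℓ) ⟨
        2 ^ ℓ * 2 ^ (ℓ + ℓ)          ≡⟨ ^-distribˡ-+-* 2 ℓ (ℓ + ℓ) ⟨
        2 ^ (ℓ + (ℓ + ℓ))            ≡⟨ cong (λ z → 2 ^ (ℓ + (ℓ + z))) (+-identityʳ ℓ) ⟨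
        2 ^ (3 * ℓ)                  ∎
        where open ≤-Reasoning

      -- Bounding `m` by 2^(m-1) instead of 2^m is decisive: `m ^ n` then takes up (m-1)n of the
      -- available exponent mn, and the remaining n exceeds ℓm + 3ℓ + 2m².
      few : ∀ m → m ≤ 10 * ℓ → n ^ m * m ^ n * (n * (n * suc K)) ≤ 2 ^ (m * (n ∸ 2 * m))
      -- A nonempty set has no map with zero classes: `0 ^ n` vanishes.
      few zero    _ = subst (λ z → 1 * z * (n * (n * suc K)) ≤ 1) (sym (0^n 1≤n)) z≤n
        where
        0^n : ∀ {n} → 1 ≤ n → 0 ^ n ≡ 0
        0^n (s≤s _) = refl
      few m@(suc m′) m≤ = begin
        n ^ m * m ^ n * (n * (n * suc K))
          ≤⟨ *-mono-≤ (*-mono-≤ (^-monoˡ-≤ m n≤2^ℓ) (^-monoˡ-≤ n (suc≤2^ m′))) slack ⟩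
        (2 ^ ℓ) ^ m * (2 ^ m′) ^ n * 2 ^ (3 * ℓ)
          ≡⟨ cong₂ (λ x y → x * y * 2 ^ (3 * ℓ)) (^-*-assoc 2 ℓ m) (^-*-assoc 2 m′ n) ⟩
        2 ^ (ℓ * m) * 2 ^ (m′ * n) * 2 ^ (3 * ℓ)
          ≡⟨ cong (_* 2 ^ (3 * ℓ)) (^-distribˡ-+-* 2 (ℓ * m) (m′ * n)) ⟨
        2 ^ (ℓ * m + m′ * n) * 2 ^ (3 * ℓ)
          ≡⟨ ^-distribˡ-+-* 2 (ℓ * m + m′ * n) (3 * ℓ) ⟨
        2 ^ (ℓ * m + m′ * n + 3 * ℓ)
          ≤⟨ ^-monoʳ-≤ 2 (≤-trans (m+n≤o⇒m≤o∸n (ℓ * m + m′ * n + 3 * ℓ) exponent)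
              (≤-reflexive (sym (*-distribˡ-∸ m n (2 * m))))) ⟩
        2 ^ (m * (n ∸ 2 * m)) ∎
        where
        open ≤-Reasoning
        regroup : ∀ ℓ m m′ n → ℓ * m + m′ * n + 3 * ℓ + m * (2 * m) ≡ ℓ * m + 3 * ℓ + m * (2 * m) + m′ * n
        regroup = solve-∀
        collect : ∀ ℓ → ℓ * (10 * ℓ) + 3 * (ℓ * ℓ) + 10 * ℓ * (2 * (10 * ℓ)) ≡ 213 * (ℓ * ℓ)
        collect = solve-∀
        ℓ≤ℓ² : ℓ ≤ ℓ * ℓ
        ℓ≤ℓ² = m≤m*n ℓ ℓ {{>-nonZero (≤-trans (s≤s z≤n) 20≤ℓ)}}
        exponent : ℓ * m + m′ * n + 3 * ℓ + m * (2 * m) ≤ m * n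
        exponent = begin
          ℓ * m + m′ * n + 3 * ℓ + m * (2 * m)   ≡⟨ regroup ℓ m m′ n ⟩
          ℓ * m + 3 * ℓ + m * (2 * m) + m′ * n
            ≤⟨ +-monoˡ-≤ (m′ * n) (+-mono-≤ (+-mono-≤ (*-monoʳ-≤ ℓ m≤) (*-monoʳ-≤ 3 ℓ≤ℓ²))
                (*-mono-≤ m≤ (*-monoʳ-≤ 2 m≤))) ⟩
          ℓ * (10 * ℓ) + 3 * (ℓ * ℓ) + 10 * ℓ * (2 * (10 * ℓ)) + m′ * n
            ≡⟨ cong (_+ m′ * n) (collect ℓ) ⟩
          213 * (ℓ * ℓ) + m′ * n                 ≤⟨ +-monoˡ-≤ (m′ * n) 213ℓ²≤n ⟩
          n + m′ * n                             ∎

      -- The 5 in `d` is 2 + 3: the maps cost at most 2ℓk binary digits and `slack` at most 3ℓ ≤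
      -- 3ℓk, as k ≥ 1. The gain needs 10ℓ + 1 ≤ m, which fixes the cut between the two ranges.
      many : ∀ m → 10 * ℓ < m → m < n →
        ∃[ d ] 2 * d + (n ∸ m) ≤ (n ∸ m) * m × (n * n) ^ (n ∸ m) * (n * (n * suc K)) ≤ 2 ^ d
      many m 10ℓ<m m<n = 5 * (ℓ * k) , gain , cost
        where
        open ≤-Reasoning
        k = n ∸ m
        collect : ∀ ℓ k → 2 * (5 * (ℓ * k)) + k ≡ k * suc (10 * ℓ)
        collect = solve-∀
        gain : 2 * (5 * (ℓ * k)) + k ≤ k * m
        gain = begin
          2 * (5 * (ℓ * k)) + k    ≡⟨ collect ℓ k ⟩
          k * suc (10 * ℓ)         ≤⟨ *-monoʳ-≤ k 10ℓ<m ⟩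
          k * m                    ∎
        ℓ≤ℓk : ℓ ≤ ℓ * k
        ℓ≤ℓk = m≤m*n ℓ k {{>-nonZero (m<n⇒0<n∸m m<n)}}
        split : ∀ x → 2 * x + 3 * x ≡ 5 * x
        split = solve-∀
        twice : ∀ ℓ k → (ℓ + ℓ) * k ≡ 2 * (ℓ * k)
        twice = solve-∀
        cost : (n * n) ^ k * (n * (n * suc K)) ≤ 2 ^ (5 * (ℓ * k))
        cost = begin
          (n * n) ^ k * (n * (n * suc K))      ≤⟨ *-mono-≤ (^-monoˡ-≤ k (*-mono-≤ n≤2^ℓ n≤2^ℓ)) slack ⟩
          (2 ^ ℓ * 2 ^ ℓ) ^ k * 2 ^ (3 * ℓ)    ≡⟨ cong (λ z → z ^ k * 2 ^ (3 * ℓ)) (^-distribˡ-+-* 2 ℓ ℓ) ⟨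
          (2 ^ (ℓ + ℓ)) ^ k * 2 ^ (3 * ℓ)
            ≡⟨ cong (_* 2 ^ (3 * ℓ)) (trans (^-*-assoc 2 (ℓ + ℓ) k) (cong (2 ^_) (twice ℓ k))) ⟩
          2 ^ (2 * (ℓ * k)) * 2 ^ (3 * ℓ)      ≤⟨ *-monoʳ-≤ (2 ^ (2 * (ℓ * k))) (^-monoʳ-≤ 2 (*-monoʳ-≤ 3 ℓ≤ℓk)) ⟩
          2 ^ (2 * (ℓ * k)) * 2 ^ (3 * (ℓ * k)) ≡⟨ ^-distribˡ-+-* 2 (2 * (ℓ * k)) (3 * (ℓ * k)) ⟨
          2 ^ (2 * (ℓ * k) + 3 * (ℓ * k))      ≡⟨ cong (2 ^_) (split (ℓ * k)) ⟩
          2 ^ (5 * (ℓ * k))                    ∎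

    threshold-nonZero : NonZero n
    threshold-nonZero = >-nonZero 1≤n

    few-or-many : ∀ m → m < n →
      (n ^ m * m ^ n * (n * (n * suc K)) ≤ 2 ^ (m * (n ∸ 2 * m))) ⊎
      (∃[ d ] 2 * d + (n ∸ m) ≤ (n ∸ m) * m × (n * n) ^ (n ∸ m) * (n * (n * suc K)) ≤ 2 ^ d)
    few-or-many m m<n with m ≤? 10 * ℓ
    ... | yes m≤ = inj₁ (few m m≤)
    ... | no m≰  = inj₂ (many m (≰⇒> m≰) m<n)

open Asymptotics

-- Separating vertices by integer vectors: refinement modulo primes, then Euclidean descent.

module IntegerSeparation where

  open import Data.Nat as ℕ using (ℕ; zero; suc; z≤n; s≤s)
  import Data.Nat.Properties as ℕ
  import Data.Nat.Divisibility as ℕ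
  open import Data.Integer as ℤ
    using (ℤ; +_; -[1+_]; 0ℤ; 1ℤ; -1ℤ; _+_; _*_; _-_; -_; ∣_∣)
  import Data.Integer.Properties as ℤ
  open import Data.Integer.Divisibility.Signed
  open import Data.Integer.Tactic.RingSolver using (solve-∀)
  open import Algebra.Properties.Semiring.Sum ℤ.+-*-semiring using (sum; sum-cong-≗; *-distribˡ-sum)
  open import Relation.Binary.PropositionalEquality
  open import Data.Nat.Primality using (Prime; euclidsLemma; prime[2]; ¬prime[0]; ¬prime[1])
  open import Data.Nat.Primality.Factorisation using (factorise; PrimeFactorisation)
  open import Data.Nat.ListAction using (product)
  open import Data.Nat.Induction using (<-wellFounded)
  open import Induction.WellFounded using (Acc; acc)
  open import Data.Integer.DivMod using (a≡a%n+[a/n]*n; n%d<d; _/_; _%_)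

  prod : ∀ {m} → (Fin m → ℤ) → ℤ
  prod {zero}  f = 1ℤ
  prod {suc m} f = f zero * prod (f ∘ suc)

  prod-zero : ∀ {m} (f : Fin m → ℤ) i → f i ≡ 0ℤ → prod f ≡ 0ℤ
  prod-zero f zero    eq rewrite eq = refl
  prod-zero f (suc i) eq rewrite prod-zero (f ∘ suc) i eq = ℤ.*-zeroʳ (f zero)

  prod-one : ∀ {m} (f : Fin m → ℤ) → (∀ i → f i ≡ 1ℤ) → prod f ≡ 1ℤ
  prod-one {zero}  f h = refl
  prod-one {suc m} f h rewrite h zero | prod-one (f ∘ suc) (h ∘ suc) = refl

  mod-prod : ∀ {m p} {f g : Fin m → ℤ} → (∀ i → f i ≡ g i [mod p ]) → prod f ≡ prod g [mod p ]
  mod-prod {zero}  h = mod-refl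
  mod-prod {suc m} h = mod-* (h zero) (mod-prod (h ∘ suc))

  prime∣* : ∀ {p} → Prime p → ∀ a b → + p ∣ a * b → (+ p ∣ a) ⊎ (+ p ∣ b)
  prime∣* {p} pr a b h with euclidsLemma ∣ a ∣ ∣ b ∣ pr (subst (p ℕ.∣_) (ℤ.abs-* a b) (∣⇒∣ᵤ h))
  ... | inj₁ u = inj₁ (∣ᵤ⇒∣ u)
  ... | inj₂ v = inj₂ (∣ᵤ⇒∣ v)

  prime∤prod : ∀ {m p} → Prime p → (f : Fin m → ℤ) → (∀ i → ¬ + p ∣ f i) → ¬ + p ∣ prod f
  prime∤prod {zero}  pr f h d = ¬prime[1] (subst Prime (ℕ.∣1⇒≡1 (∣⇒∣ᵤ d)) pr)
  prime∤prod {suc m} pr f h d with prime∣* pr (f zero) _ d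
  ... | inj₁ d₀ = h zero d₀
  ... | inj₂ d₁ = prime∤prod pr (f ∘ suc) (h ∘ suc) d₁

  prime-divisor : ∀ m → 2 ℕ.≤ m → ∃[ p ] Prime p × p ℕ.∣ m
  prime-divisor m 2≤m = first factors isFactorisation factorsPrime
    where
    open PrimeFactorisation (factorise m {{ℕ.>-nonZero (ℕ.<-trans (s≤s z≤n) 2≤m)}})
    first : ∀ ps → m ≡ product ps → All Prime ps → ∃[ p ] Prime p × p ℕ.∣ m
    first []       refl _        = contradiction 2≤m λ { (s≤s ()) }
    first (p ∷ ps) eq   (pr ∷ _) = p , pr , subst (p ℕ.∣_) (sym eq) (ℕ.m∣m*n (product ps))

  headOr : ∀ {a : Level} {A : Set a} → A → List A → A
  headOr d []      = d
  headOr d (x ∷ _) = x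

  headOr-∈ : ∀ {a : Level} {A : Set a} {d x : A} {xs} → x ∈ xs → headOr d xs ∈ xs
  headOr-∈ {xs = _ ∷ _} _ = here refl

  headOr-default : ∀ {a : Level} {A : Set a} {d e x : A} {xs} → x ∈ xs → headOr d xs ≡ headOr e xs
  headOr-default {xs = _ ∷ _} _ = refl

  module Representative {_∼_ : Fin n → Fin n → Set} (_∼?_ : ∀ u v → Dec (u ∼ v))
    (∼-refl : ∀ {u} → u ∼ u) (∼-sym : ∀ {u v} → u ∼ v → v ∼ u) (∼-trans : ∀ {u v w} → u ∼ v → v ∼ w → u ∼ w) where

    class : Fin n → List (Fin n)
    class u = filter (_∼? u) (allFin n)

    ∈-class : ∀ u → u ∈ class u
    ∈-class u = ∈-filter⁺ (_∼? u) (∈-allFin u) ∼-refl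

    abstract
      rep : Fin n → Fin n
      rep u = headOr u (class u)

      rep-∼ : ∀ u → rep u ∼ u
      rep-∼ u = proj₂ (∈-filter⁻ (_∼? u) {xs = allFin n} (headOr-∈ (∈-class u)))

      -- Equivalent vertices have the same list as `class`. The defaults given to `headOr` still
      -- differ, but a class is nonempty, so they are never reached.
      rep-cong : ∀ {u v} → u ∼ v → rep u ≡ rep v
      rep-cong {u} {v} u∼v = trans
        (cong (headOr u) (filter-≐ (_∼? u) (_∼? v)
          ((λ w∼u → ∼-trans w∼u u∼v) , (λ w∼v → ∼-trans w∼v (∼-sym u∼v))) (allFin n)))
        (headOr-default (∈-class v))

      rep-reflects : ∀ {u v} → rep u ≡ rep v → u ∼ v
      rep-reflects {u} {v} eq = ∼-trans (∼-sym (rep-∼ u)) (subst (_∼ v) (sym eq) (rep-∼ v))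

      rep-idempotent : Idempotent rep
      rep-idempotent u = rep-cong (rep-∼ u)

  weightInto-bounds : ∀ (g : Graph n) ρ u c → ∃[ k ] k ℕ.≤ n × weightInto (adjacency {n} g) ρ u c ≡ + k
  weightInto-bounds {n} g ρ u c = bits-sum (λ w → adj {n} g u w) (λ w → does (ρ w Fin.≟ c))
    where
    bit : ∀ a b → ∃[ k ] k ℕ.≤ 1 × 𝟙 a * 𝟙 b ≡ + k
    bit true  true  = 1 , s≤s z≤n , refl
    bit true  false = 0 , z≤n , refl
    bit false true  = 0 , z≤n , refl
    bit false false = 0 , z≤n , refl
    bits-sum : ∀ {m} (a b : Fin m → Bool) → ∃[ k ] k ℕ.≤ m × sum (λ w → 𝟙 (a w) * 𝟙 (b w)) ≡ + k
    bits-sum {zero}  a b = 0 , z≤n , refl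
    bits-sum {suc m} a b with bit (a zero) (b zero) | bits-sum (a ∘ suc) (b ∘ suc)
    ... | k , k≤ , eq | l , l≤ , eq′ = k ℕ.+ l , ℕ.+-mono-≤ k≤ l≤ , cong₂ _+_ eq eq′

  small-mod⇒≡ : ∀ {p k l} → k ℕ.< p → l ℕ.< p → + k ≡ + l [mod + p ] → k ≡ l
  small-mod⇒≡ {p} {k} {l} k<p l<p (∣-difference h) with ∣ + k - + l ∣ in eq
  ... | zero  = ℤ.+-injective (ℤ.i-j≡0⇒i≡j (+ k) (+ l) (ℤ.∣i∣≡0⇒i≡0 eq))
  ... | suc e = contradiction (ℕ.∣⇒≤ (subst (p ℕ.∣_) eq (∣⇒∣ᵤ h))) (ℕ.<⇒≱ (subst (ℕ._< p) eq bound))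
    where
    bound : ∣ + k - + l ∣ ℕ.< p
    bound = ℕ.≤-<-trans (subst (λ z → ∣ z ∣ ℕ.≤ k ℕ.⊔ l) (sym (ℤ.m-n≡m⊖n k l)) (ℤ.∣m⊝n∣≤m⊔n k l)) (ℕ.⊔-lub k<p l<p)

  rigid⇒inequitable : ∀ {g : Graph n} → Rigid {n} g → ∀ ρ → Idempotent ρ → ∃ (λ u → ρ u ≢ u) →
    ∀ q → ¬ Equitable q (adjacency {n} g) ρ
  rigid⇒inequitable {n} {g} rigid ρ idem w@(x , _) q eg with q ℕ.<? n
  ... | yes q<n = rigid ρ idem w q q<n eg
  -- For a large modulus the congruences are equalities, so they hold modulo 2 as well, a case that
  -- `Rigid` covers.
  ... | no q≮n  = rigid ρ idem w 0 (ℕ.≤-<-trans z≤n (Fin.toℕ<n x)) exact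
    where
    small : ∀ {k} → k ℕ.≤ n → k ℕ.< suc (suc q)
    small k≤ = s≤s (ℕ.≤-trans k≤ (ℕ.≤-trans (ℕ.≮⇒≥ q≮n) (ℕ.n≤1+n q)))
    -- Class degrees are at most n, so a congruence modulo q + 2 > n between them is an equality.
    exact : Equitable 0 (adjacency {n} g) ρ
    exact u r = let k , k≤ , eq  = weightInto-bounds {n} g ρ u (ρ r)
                    l , l≤ , eq′ = weightInto-bounds {n} g ρ (ρ u) (ρ r)
      in mod-reflexive (trans eq (trans
           (cong +_ (small-mod⇒≡ (small k≤) (small l≤) (subst₂ (_≡_[mod + suc (suc q) ]) eq eq′ (eg u r))))
           (sym eq′)))

  -- `P` abstracts from the closure over the field: it will hold of the vectors whose row-constant
  -- matrices lie in F⟨⟨A⟩⟩, and the closure properties listed are all that the integer argument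
  -- sees.
  module Separation {n : ℕ} (A : Fin n → Fin n → ℤ)
    (inequitable : ∀ ρ → Idempotent ρ → ∃ (λ u → ρ u ≢ u) → ∀ q → ¬ Equitable q A ρ)
    {ℓ : Level} (P : (Fin n → ℤ) → Set ℓ)
    (P-const : ∀ c → P (λ _ → c))
    (P-+ : ∀ {x y} → P x → P y → P (λ i → x i + y i))
    (P-* : ∀ {x y} → P x → P y → P (λ i → x i * y i))
    (P-image : ∀ {x} → P x → P (λ i → sum (λ w → A i w * x w)))
    where

    P-prod : ∀ {m} (z : Fin m → Fin n → ℤ) → (∀ j → P (z j)) → P (λ i → prod (λ j → z j i))
    P-prod {zero}  z h = P-const 1ℤ
    P-prod {suc m} z h = P-* (h zero) (P-prod (z ∘ suc) (h ∘ suc))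

    P-shift : ∀ {x} → P x → ∀ c → P (λ i → x i - c)
    P-shift Px c = P-+ Px (P-const (- c))

    module Modular (q : ℕ) (pr : Prime (suc (suc q))) where

      p : ℤ
      p = + suc (suc q)

      private
        image : (Fin n → ℤ) → Fin n → ℤ
        image y i = sum (λ w → A i w * y w)

      Indist : List (∃ P) → Fin n → Fin n → Set
      Indist xs u v = ∀ i → proj₁ (List.lookup xs i) u ≡ proj₁ (List.lookup xs i) v [mod p ]

      abstract
        indist? : ∀ xs u v → Dec (Indist xs u v)
        indist? xs u v = Fin.all? λ i → proj₁ (List.lookup xs i) u ≡? proj₁ (List.lookup xs i) v [mod p ]

      tell : ∀ xs {u v} → ¬ Indist xs u v → ∃[ i ] ¬ proj₁ (List.lookup xs i) u ≡ proj₁ (List.lookup xs i) v [mod p ]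
      tell xs {u} {v} = Fin.¬∀⟶∃¬ (length xs)
        (λ i → proj₁ (List.lookup xs i) u ≡ proj₁ (List.lookup xs i) v [mod p ])
        (λ i → proj₁ (List.lookup xs i) u ≡? proj₁ (List.lookup xs i) v [mod p ])

      Separates : Fin n → Fin n → Set ℓ
      Separates u v = ∃[ x ] P x × ¬ x u ≡ x v [mod p ]

      distinguish : ∀ xs {u v} → ¬ Indist xs u v → Separates u v
      distinguish xs {u} {v} ¬ind = let i , ne = tell xs ¬ind in
        proj₁ (List.lookup xs i) , proj₂ (List.lookup xs i) , ne

      private
        everyPair : List (Fin n × Fin n)
        everyPair = cartesianProduct (allFin n) (allFin n)

        indistPair? : ∀ xs → Decidable (λ (uv : Fin n × Fin n) → Indist xs (proj₁ uv) (proj₂ uv))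
        indistPair? xs (u , v) = indist? xs u v

        indistPairs : List (∃ P) → ℕ
        indistPairs xs = length (filter (indistPair? xs) everyPair)

      -- One round of refinement. Since `a` and `b` agree on `xs`, the partition given by `xs` is
      -- not discrete, hence not equitable modulo `p`. The image under `A` of a vector supported
      -- modulo `p` on the violated class then tells `u` from its representative.
      module Split (xs : List (∃ P)) {a b : Fin n} (a≢b : a ≢ b) (ab : Indist xs a b) where

        open Representative (indist? xs) (λ _ → mod-refl) (λ h i → mod-sym (h i)) (λ h k i → mod-trans (h i) (k i))

        not-discrete : ∃ (λ u → rep u ≢ u)
        not-discrete = decide (rep a Fin.≟ a) (rep b Fin.≟ b)
          where
          decide : Dec (rep a ≡ a) → Dec (rep b ≡ b) → ∃ (λ u → rep u ≢ u)
          decide (no ne)  _         = a , ne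
          decide (yes _)  (no ne)   = b , ne
          decide (yes eq) (yes eq′) = contradiction (trans (sym eq) (trans (rep-cong ab) eq′)) a≢b

        Balanced : Fin n → Fin n → Set
        Balanced u r = weightInto A rep u (rep r) ≡ weightInto A rep (rep u) (rep r) [mod p ]

        balanced? : ∀ u r → Dec (Balanced u r)
        balanced? u r = weightInto A rep u (rep r) ≡? weightInto A rep (rep u) (rep r) [mod p ]

        abstract
          violation : ∃[ u ] ∃[ r ] ¬ Balanced u r
          violation = proj₁ first , Fin.¬∀⟶∃¬ n (Balanced (proj₁ first)) (balanced? (proj₁ first)) (proj₂ first)
            where
            first : ∃[ u ] ¬ (∀ r → Balanced u r)
            first = Fin.¬∀⟶∃¬ n (λ u → ∀ r → Balanced u r) (λ u → Fin.all? (balanced? u))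
              (inequitable rep rep-idempotent not-discrete q)

        u r : Fin n
        u = proj₁ violation
        r = proj₁ (proj₂ violation)

        -- One factor for each vertex `w`. Outside the class of `r` it vanishes at `w` exactly; on
        -- that class all factors are constant and nonzero modulo `p`, and so is their product.
        Factor : Fin n → Set ℓ
        Factor w = ∃[ z ] P z × (rep w ≢ rep r → z w ≡ 0ℤ) × ¬ p ∣ z r ×
          (∀ v → rep v ≡ rep r → z v ≡ z r [mod p ])

        factor-yes : ∀ w → Indist xs w r → Factor w
        factor-yes w w∼r = (λ _ → 1ℤ) , P-const 1ℤ , (λ ne → contradiction (rep-cong w∼r) ne) ,
          -- The empty product is 1, so this says that `p` does not divide 1.
          prime∤prod {0} pr (λ ()) (λ ()) , (λ v _ → mod-refl)

        factor-no : ∀ w → ¬ Indist xs w r → Factor w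
        factor-no w w≁r = (λ v → x v - x w) , P-shift (proj₂ (List.lookup xs i)) (x w) ,
          (λ _ → ℤ.+-inverseʳ (x w)) , (λ d → proj₂ (tell xs w≁r) (mod-sym (∣-difference d))) ,
          (λ v eq → mod-+ (rep-reflects eq i) (mod-refl {a = - x w}))
          where
          i = proj₁ (tell xs w≁r)
          x = proj₁ (List.lookup xs i)

        abstract
          factor : ∀ w → Factor w
          factor w = decide (indist? xs w r)
            where
            decide : Dec (Indist xs w r) → Factor w
            decide (yes w∼r) = factor-yes w w∼r
            decide (no w≁r)  = factor-no w w≁r

        -- A multiple of the indicator of the class of r modulo p.
        y : Fin n → ℤ
        y v = prod (λ w → proj₁ (factor w) v)

        Py : P y
        Py = P-prod (λ w → proj₁ (factor w)) (λ w → proj₁ (proj₂ (factor w)))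

        y-mod : ∀ w → y w ≡ y r * 𝟙 (does (rep w Fin.≟ rep r)) [mod p ]
        y-mod w = decide (rep w Fin.≟ rep r)
          where
          decide : (d : Dec (rep w ≡ rep r)) → y w ≡ y r * 𝟙 (does d) [mod p ]
          decide (no ne)  = mod-reflexive (trans
            (prod-zero (λ j → proj₁ (factor j) w) w (proj₁ (proj₂ (proj₂ (factor w))) ne))
            (sym (ℤ.*-zeroʳ (y r))))
          decide (yes eq) = subst (λ z → y w ≡ z [mod p ]) (sym (ℤ.*-identityʳ (y r)))
            (mod-prod (λ j → proj₂ (proj₂ (proj₂ (proj₂ (factor j)))) w eq))

        y-r : ¬ p ∣ y r
        y-r = prime∤prod pr (λ w → proj₁ (factor w) r) (λ w → proj₁ (proj₂ (proj₂ (proj₂ (factor w)))))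

        image-mod : ∀ v → image y v ≡ y r * weightInto A rep v (rep r) [mod p ]
        image-mod v = subst (λ z → image y v ≡ z [mod p ])
          (trans (sum-cong-≗ (λ w → rotate (A v w) (y r) (𝟙 (does (rep w Fin.≟ rep r)))))
                 (sym (*-distribˡ-sum (y r) (λ w → A v w * 𝟙 (does (rep w Fin.≟ rep r))))))
          (mod-sum (λ w → mod-* (mod-refl {a = A v w}) (y-mod w)))
          where
          rotate : ∀ a b c → a * (b * c) ≡ b * (a * c)
          rotate = solve-∀

        deg : Fin n → ℤ
        deg v = weightInto A rep v (rep r)

        factor-out : ∀ c a b → c * a - c * b ≡ c * (a - b)
        factor-out = solve-∀

        -- The two values differ modulo `p` by `y r` times the difference of the class degrees. By
        -- primality `p` would divide one of these factors, which `y-r` and `violation` exclude.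
        image-separates : ¬ image y u ≡ image y (rep u) [mod p ]
        image-separates h = [ y-r , (λ d → proj₂ (proj₂ violation) (∣-difference d)) ]′
          (prime∣* pr (y r) (deg u - deg (rep u)) (subst (p ∣_) (factor-out (y r) (deg u) (deg (rep u)))
            (difference (mod-trans (mod-sym (image-mod u)) (mod-trans h (image-mod (rep u)))))))

        refined : List (∃ P)
        refined = (image y , P-image Py) ∷ xs

        -- The number of indistinguishable ordered pairs is the termination measure: it loses
        -- `(u , rep u)`.
        refined-< : indistPairs refined ℕ.< indistPairs xs
        refined-< = length-filter-⊂ (indistPair? refined) (indistPair? xs) (λ h i → h (suc i))
          {y = u , rep u} (∈-cartesianProduct⁺ (∈-allFin u) (∈-allFin (rep u)))
          (λ i → rep-reflects {u} {rep u} (sym (rep-idempotent u)) i) (λ h → image-separates (h zero))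

      -- Refinement goes on while two distinct vertices agree on all of `xs`; afterwards `xs` itself
      -- separates every pair.
      separate-from : ∀ xs → Acc ℕ._<_ (indistPairs xs) → ∀ u v → u ≢ v → Separates u v
      separate-from xs (acc rs) with Fin.any? (λ a → Fin.any? (λ b → ¬? (a Fin.≟ b) ×-dec indist? xs a b))
      ... | yes (a , b , a≢b , ab) = separate-from (Split.refined xs a≢b ab) (rs (Split.refined-< xs a≢b ab))
      ... | no none = λ u v u≢v → distinguish xs (λ ind → none (u , v , u≢v , ind))

      separate : ∀ u v → u ≢ v → Separates u v
      separate = separate-from [] (<-wellFounded _)

    separate-prime : ∀ p → Prime p → ∀ u v → u ≢ v → ∃[ x ] P x × ¬ x u ≡ x v [mod + p ]
    separate-prime 0             pr = contradiction pr ¬prime[0]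
    separate-prime 1             pr = contradiction pr ¬prime[1]
    separate-prime (suc (suc q)) pr = Modular.separate q pr

    module Unit (u v : Fin n) (u≢v : u ≢ v) where

      -- Descent on the absolute value of the difference, down to 1 or -1. Each round uses a prime
      -- divisor of the current difference, hence the need to separate modulo every prime.
      descend : ∀ x → P x → x u - x v ≢ 0ℤ → Acc ℕ._<_ ∣ x u - x v ∣ → ∃[ y ] P y × y u - y v ≡ 1ℤ

      -- A prime divisor of d does not divide some other difference d′, so d′ mod d is nonzero.
      reduce : ∀ x → P x → ∀ d → d ≡ x u - x v → .{{_ : ℤ.NonZero d}} → 2 ℕ.≤ ∣ d ∣ →
        (∀ {m} → m ℕ.< ∣ d ∣ → Acc ℕ._<_ m) → ∃[ y ] P y × y u - y v ≡ 1ℤ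
      reduce x Px d eq 2≤ rs with prime-divisor ∣ d ∣ 2≤
      ... | p , pr , p∣d with separate-prime p pr u v u≢v
      ...   | x′ , Px′ , ne = descend x″ (P-+ Px′ (P-* (P-const (- quot)) Px))
                (λ e → rem≢0 (ℤ.+-injective (trans (sym diff) e)))
                (rs (subst (ℕ._< ∣ d ∣) (sym (cong ∣_∣ diff)) (n%d<d d′ d)))
        where
        d′ quot : ℤ
        d′   = x′ u - x′ v
        quot = d′ / d
        x″ : Fin n → ℤ
        x″ i = x′ i + - quot * x i
        diff : x″ u - x″ v ≡ + (d′ % d)
        diff = trans (regroup (x′ u) (x′ v) quot (x u) (x v))
          (trans (cong (λ z → d′ - quot * z) (sym eq))
          (trans (cong (_- quot * d) (a≡a%n+[a/n]*n d′ d)) (cancel (+ (d′ % d)) (quot * d))))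
          where
          regroup : ∀ a b q c e → (a + - q * c) - (b + - q * e) ≡ (a - b) - q * (c - e)
          regroup = solve-∀
          cancel : ∀ a b → a + b - b ≡ a
          cancel = solve-∀
        rem≢0 : d′ % d ≢ 0
        rem≢0 e = ne (∣-difference (subst (+ p ∣_)
          (sym (trans (a≡a%n+[a/n]*n d′ d) (trans (cong (λ z → + z + quot * d) e) (ℤ.+-identityˡ _))))
          (∣n⇒∣m*n quot (∣ᵤ⇒∣ {+ p} {d} p∣d))))

      descend x Px ne (acc rs) with x u - x v in eq
      ... | + 0                = contradiction refl ne
      ... | + 1                = x , Px , eq
      ... | d@(+ suc (suc _))  = reduce x Px d (sym eq) (s≤s (s≤s z≤n)) rs
      ... | -[1+ 0 ]           = (λ i → -1ℤ * x i) , P-* (P-const -1ℤ) Px , trans (negate (x u) (x v)) (cong (-_) eq)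
        where
        negate : ∀ a b → -1ℤ * a - -1ℤ * b ≡ - (a - b)
        negate = solve-∀
      ... | d@(-[1+ suc _ ])   = reduce x Px d (sym eq) (s≤s (s≤s z≤n)) rs

    unit-difference : ∀ u v → u ≢ v → ∃[ x ] P x × x u - x v ≡ 1ℤ
    -- Any prime would do here: incongruent values are different, which gives the descent a nonzero
    -- start.
    unit-difference u v u≢v with separate-prime 2 prime[2] u v u≢v
    ... | x , Px , ne = Unit.descend u v u≢v x Px
      (λ eq → ne (∣-difference (subst (+ 2 ∣_) (sym eq) (divides 0ℤ refl)))) (<-wellFounded _)

    -- The product over `v ≢ u` of the vectors `x i - x v`, where `x u - x v` is 1. As the value at
    -- `u` is exactly 1, nothing has to be inverted.
    indicator : ∀ u → ∃[ e ] P e × e u ≡ 1ℤ × (∀ v → v ≢ u → e v ≡ 0ℤ)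
    indicator u = (λ i → prod (λ v → proj₁ (factor v) i)) ,
      P-prod (λ v → proj₁ (factor v)) (λ v → proj₁ (proj₂ (factor v))) ,
      prod-one (λ v → proj₁ (factor v) u) (λ v → proj₁ (proj₂ (proj₂ (factor v)))) ,
      λ v v≢u → prod-zero (λ w → proj₁ (factor w) v) v (proj₂ (proj₂ (proj₂ (factor v))) v≢u)
      where
      factor : ∀ v → ∃[ z ] P z × z u ≡ 1ℤ × (v ≢ u → z v ≡ 0ℤ)
      factor v with v Fin.≟ u
      ... | yes eq = (λ _ → 1ℤ) , P-const 1ℤ , refl , (λ ne → contradiction eq ne)
      ... | no v≢u with unit-difference u v (v≢u ∘ sym)
      ...   | x , Px , eq = (λ i → x i - x v) , P-shift Px (x v) , eq , (λ _ → ℤ.+-inverseʳ (x v))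

open IntegerSeparation

-- Transfer from integer vectors to matrices over the field.

module FieldSide {c ℓ : Level} (F : Field c ℓ) where

  open import Data.Nat as ℕ using (ℕ; zero; suc)
  import Data.Nat.Properties as ℕ
  open import Data.Integer as ℤ using (ℤ; +_; -[1+_]; 1ℤ; _⊖_)
  import Data.Integer.Properties as ℤ
  import Algebra.Properties.Ring as RingProperties
  import Algebra.Properties.Semiring.Mult as Mult
  import Algebra.Properties.Semiring.Sum as Sum
  import Relation.Binary.Reasoning.Setoid as SetoidReasoning
  open import Relation.Binary.PropositionalEquality as ≡ using (_≡_; _≢_)

  open Field F hiding (zero)
  open RingProperties ring using (-‿distribˡ-*; -‿distribʳ-*; -‿+-comm; -0#≈0#; -‿involutive)
  open Mult semiring using (×-homo-+; ×1-homo-*) renaming (_×_ to _·_)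
  open SetoidReasoning setoid
  private module Σℤ = Sum ℤ.+-*-semiring

  -- The ring homomorphism from ℤ to the field. It need not be injective: the vectors obtained in
  -- the end take only the values 0 and 1, which it respects.
  ι : ℤ → Carrier
  ι (+ n)      = n · 1#
  ι (-[1+ n ]) = - (suc n · 1#)

  ι-⊖ : ∀ m n → ι (m ⊖ n) ≈ m · 1# - n · 1#
  ι-⊖ m       zero    = sym (trans (+-congˡ -0#≈0#) (+-identityʳ _))
  ι-⊖ zero    (suc n) = sym (+-identityˡ _)
  ι-⊖ (suc m) (suc n) = begin
    ι (suc m ⊖ suc n)                       ≡⟨ ≡.cong ι (ℤ.[1+m]⊖[1+n]≡m⊖n m n) ⟩
    ι (m ⊖ n)                               ≈⟨ ι-⊖ m n ⟩
    m · 1# - n · 1#                         ≈⟨ +-identityˡ _ ⟨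
    0# + (m · 1# - n · 1#)                  ≈⟨ +-congʳ (-‿inverseʳ 1#) ⟨
    (1# - 1#) + (m · 1# - n · 1#)           ≈⟨ +-assoc _ _ _ ⟩
    1# + (- 1# + (m · 1# - n · 1#))         ≈⟨ +-congˡ (+-assoc _ _ _) ⟨
    1# + ((- 1# + m · 1#) - n · 1#)         ≈⟨ +-congˡ (+-congʳ (+-comm _ _)) ⟩
    1# + ((m · 1# - 1#) - n · 1#)           ≈⟨ +-congˡ (+-assoc _ _ _) ⟩
    1# + (m · 1# + (- 1# - n · 1#))         ≈⟨ +-assoc _ _ _ ⟨
    suc m · 1# + (- 1# - n · 1#)            ≈⟨ +-congˡ (-‿+-comm 1# _) ⟩
    suc m · 1# - suc n · 1#                 ∎

  ι-+ : ∀ i j → ι (i ℤ.+ j) ≈ ι i + ι j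
  ι-+ (+ m)      (+ n)      = ×-homo-+ 1# m n
  ι-+ (+ m)      (-[1+ n ]) = ι-⊖ m (suc n)
  ι-+ (-[1+ m ]) (+ n)      = trans (ι-⊖ n (suc m)) (+-comm _ _)
  ι-+ (-[1+ m ]) (-[1+ n ]) = begin
    - (suc (suc (m ℕ.+ n)) · 1#)        ≡⟨ ≡.cong (λ k → - (suc k · 1#)) (ℕ.+-suc m n) ⟨
    - ((suc m ℕ.+ suc n) · 1#)          ≈⟨ -‿cong (×-homo-+ 1# (suc m) (suc n)) ⟩
    - (suc m · 1# + suc n · 1#)         ≈⟨ -‿+-comm _ _ ⟨
    - (suc m · 1#) - suc n · 1#         ∎

  ι-neg : ∀ i → ι (ℤ.- i) ≈ - ι i
  ι-neg (+ zero)   = sym -0#≈0#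
  ι-neg (+ suc n)  = refl
  ι-neg (-[1+ n ]) = sym (-‿involutive _)

  private
    ι-ℕ* : ∀ m j → ι (+ m ℤ.* j) ≈ ι (+ m) * ι j
    ι-ℕ* m (+ n)      = trans (reflexive (≡.cong ι (≡.sym (ℤ.pos-* m n)))) (×1-homo-* m n)
    ι-ℕ* m (-[1+ n ]) = begin
      ι (+ m ℤ.* -[1+ n ])        ≡⟨ ≡.cong ι (ℤ.neg-distribʳ-* (+ m) (+ suc n)) ⟨
      ι (ℤ.- (+ m ℤ.* + suc n))   ≈⟨ ι-neg (+ m ℤ.* + suc n) ⟩
      - ι (+ m ℤ.* + suc n)       ≈⟨ -‿cong (ι-ℕ* m (+ suc n)) ⟩
      - (ι (+ m) * ι (+ suc n))   ≈⟨ -‿distribʳ-* _ _ ⟩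
      ι (+ m) * ι -[1+ n ]        ∎

  ι-* : ∀ i j → ι (i ℤ.* j) ≈ ι i * ι j
  ι-* (+ m)      j = ι-ℕ* m j
  ι-* (-[1+ m ]) j = begin
    ι (-[1+ m ] ℤ.* j)          ≡⟨ ≡.cong ι (ℤ.neg-distribˡ-* (+ suc m) j) ⟨
    ι (ℤ.- (+ suc m ℤ.* j))     ≈⟨ ι-neg (+ suc m ℤ.* j) ⟩
    - ι (+ suc m ℤ.* j)         ≈⟨ -‿cong (ι-ℕ* (suc m) j) ⟩
    - (ι (+ suc m) * ι j)       ≈⟨ -‿distribˡ-* _ _ ⟩
    ι -[1+ m ] * ι j            ∎

  ι-1 : ι 1ℤ ≈ 1#
  ι-1 = +-identityʳ 1#

  ι-sum : ∀ {n} (f : Fin n → Carrier) (t : Fin n → ℤ) → (∀ k → f k ≈ ι (t k)) → Σᶠ F f ≈ ι (Σℤ.sum t)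
  ι-sum {zero}  f t h = refl
  ι-sum {suc n} f t h = trans (+-cong (h zero) (ι-sum (f ∘ suc) (t ∘ suc) (h ∘ suc)))
    (sym (ι-+ (t zero) (Σℤ.sum (t ∘ suc))))

  Σ-zero : ∀ {n} (f : Fin n → Carrier) → (∀ k → f k ≈ 0#) → Σᶠ F f ≈ 0#
  Σ-zero {zero}  f h = refl
  Σ-zero {suc n} f h = trans (+-cong (h zero) (Σ-zero (f ∘ suc) (h ∘ suc))) (+-identityˡ 0#)

  Σ-single : ∀ {n} (f : Fin n → Carrier) j → (∀ k → k ≢ j → f k ≈ 0#) → Σᶠ F f ≈ f j
  Σ-single {suc n} f zero    h = trans (+-congˡ (Σ-zero (f ∘ suc) (λ k → h (suc k) λ ()))) (+-identityʳ _)
  Σ-single {suc n} f (suc j) h = trans (+-cong (h zero λ ())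
    (Σ-single (f ∘ suc) j (λ k ne → h (suc k) (ne ∘ Fin.suc-injective)))) (+-identityˡ _)

  closure-sum : ∀ {n m} {a : Mat F n} (B : Fin m → Mat F n) → (∀ k → InClosure F a (B k)) →
    InClosure F a (λ i j → Σᶠ F (λ k → B k i j))
  closure-sum {m = zero}  B h = resp (λ i j → zeroˡ 1#) (scale 0# unit∘)
  closure-sum {m = suc m} B h = add (h zero) (closure-sum (B ∘ suc) (h ∘ suc))

  module _ {n : ℕ} (g : Graph n) where

    -- The vector is repeated in every column, so that the Hadamard product multiplies vectors
    -- entrywise, multiples of J give the constants, and left multiplication by A applies A to the
    -- vector.
    Rows : (Fin n → ℤ) → Set _
    Rows x = InClosure F (adjMat F {n} g) (λ i _ → ι (x i))

    Rows-const : ∀ c → Rows (λ _ → c)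
    Rows-const c = resp (λ i j → *-identityʳ (ι c)) (scale (ι c) unit∘)

    Rows-+ : ∀ {x y} → Rows x → Rows y → Rows (λ i → x i ℤ.+ y i)
    Rows-+ {x} {y} X Y = resp (λ i j → sym (ι-+ (x i) (y i))) (add X Y)

    Rows-* : ∀ {x y} → Rows x → Rows y → Rows (λ i → x i ℤ.* y i)
    Rows-* {x} {y} X Y = resp (λ i j → sym (ι-* (x i) (y i))) (had X Y)

    Rows-image : ∀ {x} → Rows x → Rows (λ i → Σℤ.sum (λ w → adjacency {n} g i w ℤ.* x w))
    Rows-image {x} X = resp (λ i j → ι-sum _ _ (λ w →
      trans (*-congʳ (entry (adj {n} g i w))) (sym (ι-* (adjacency {n} g i w) (x w))))) (mul gen X)
      where
      entry : ∀ b → (if b then 1# else 0#) ≈ ι (𝟙 b)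
      entry true  = sym ι-1
      entry false = refl

    module _ (rigid : Rigid {n} g) where

      open Separation (adjacency {n} g) (rigid⇒inequitable {n} {g} rigid) Rows Rows-const
        (λ {x} {y} → Rows-+ {x} {y}) (λ {x} {y} → Rows-* {x} {y}) (λ {x} → Rows-image {x})
        using (indicator)

      private
        e : Fin n → Fin n → ℤ
        e v = proj₁ (indicator v)

        ι-e-same : ∀ v → ι (e v v) ≈ 1#
        ι-e-same v = trans (reflexive (≡.cong ι (proj₁ (proj₂ (proj₂ (indicator v)))))) ι-1

        ι-e-other : ∀ v i → i ≢ v → ι (e v i) ≈ 0#
        ι-e-other v i ne = reflexive (≡.cong ι (proj₂ (proj₂ (proj₂ (indicator v))) i ne))

        row : Fin n → Mat F n
        row v i _ = ι (e v i)

        row∈ : ∀ v → InClosure F (adjMat F {n} g) (row v)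
        row∈ v = proj₁ (proj₂ (indicator v))

        col : Fin n → Mat F n
        col v _ j = ι (e v j)

        -- No constructor of `InClosure` transposes. Instead, I ∘ `row v` is the diagonal matrix
        -- unit at `v`, and J times it fills column `v` with ones.
        col∈ : ∀ v → InClosure F (adjMat F {n} g) (col v)
        col∈ v = resp (λ _ j → trans
            (Σ-single _ j (λ k k≢j → trans (*-identityˡ _) (trans (*-congʳ (I-other k j k≢j)) (zeroˡ _))))
            (trans (*-identityˡ _) (trans (*-congʳ (I-same j)) (*-identityˡ _))))
          (mul unit∘ (had unit• (row∈ v)))
          where
          I-same : ∀ j → Iₘ F j j ≈ 1#
          I-same j rewrite dec-true (j Fin.≟ j) ≡.refl = refl
          I-other : ∀ k j → k ≢ j → Iₘ F k j ≈ 0#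
          I-other k j ne rewrite dec-false (k Fin.≟ j) ne = refl

      -- The Hadamard product of `row u` and `col v` is the matrix unit at `(u , v)`; summing over
      -- `v` first builds `M` row by row.
      rigid⇒generates : GeneratesAll F (adjMat F {n} g)
      rigid⇒generates M = resp same
        (closure-sum (λ u i j → row u i j * Σᶠ F (λ v → M u v * col v i j))
          (λ u → had (row∈ u) (closure-sum (λ v i j → M u v * col v i j) (λ v → scale (M u v) (col∈ v)))))
        where
        same : ∀ i j → Σᶠ F (λ u → row u i j * Σᶠ F (λ v → M u v * col v i j)) ≈ M i j
        same i j = begin
          Σᶠ F (λ u → row u i j * Σᶠ F (λ v → M u v * col v i j))
            ≈⟨ Σ-single _ i (λ u u≢i → trans (*-congʳ (ι-e-other u i (u≢i ∘ ≡.sym))) (zeroˡ _)) ⟩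
          row i i j * Σᶠ F (λ v → M i v * col v i j)
            ≈⟨ trans (*-congʳ (ι-e-same i)) (*-identityˡ _) ⟩
          Σᶠ F (λ v → M i v * col v i j)
            ≈⟨ Σ-single _ j (λ v v≢j → trans (*-congˡ (ι-e-other v j (v≢j ∘ ≡.sym))) (zeroʳ _)) ⟩
          M i j * col j i j
            ≈⟨ trans (*-congˡ (ι-e-same j)) (*-identityʳ _) ⟩
          M i j ∎

theorem1p3 : {c ℓ : Level} (F : Field c ℓ) → ProbTendsToOne F
theorem1p3 F k = threshold k , λ n n≥ →
  let S , unique , rigid , large = most-graphs-rigid n {{threshold-nonZero k n n≥}} k (few-or-many k n n≥)
  in S , unique , All.map (λ {g} → FieldSide.rigid⇒generates F {n} g) rigid , large
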